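{- Let $p$ be an odd prime, $N_{p-2}$ the number of permutations of $p-2$ letters with an even number of ascents, $A=\frac{pB_{p-1}+1}{p}$ the Agoh–Giuga quotient, and $H'_{p-1}=1+\frac13+\dots+\frac1{p-2}$. Then the following are equivalent: (a) $p$ is a super Wieferich prime; (b) $(2N_{p-2})_0=1$ and $(2N_{p-2})_1+A\equiv2\pmod p$; (c) $(H'_{p-1})_0=(H'_{p-1})_1=0$.
   Context: A prime $p$ is called a super Wieferich prime if $q_p(2)=\frac{2^{p-1}-1}{p}\equiv0\pmod{p^2}$. For a $p$-adic integer $x$, write $x=\sum_{j\ge0}(x)_jp^j$ with digits $(x)_j\in\{0,\dots,p-1\}$. For a permutation $(i_1,\dots,i_n)$ of $\{1,\dots,n\}$, an ascent is an index $k$ with $i_{k+1}>i_k$. -}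

module Defs where

open import Data.Nat using (ℕ; zero; suc; _+_; _*_; _∸_; _^_; _≟_)
open import Data.Nat.DivMod using (_/_; _%_)
open import Data.Nat.Divisibility using (_∣_; _∣?_)
open import Data.Nat.Combinatorics using (_C_)
open import Data.Integer as ℤ using (ℤ; +_; ∣_∣)
open import Data.Rational as ℚ using (ℚ; ↥_; ↧ₙ_; 0ℚ; 1ℚ)
open import Data.List using (List; []; _∷_; [_]; map; concatMap; length; filter; upTo; zip; foldr; _++_)
open import Data.Product using (_,_)
open import Relation.Nullary using (yes; no)
open import Relation.Nullary.Decidable using (⌊_⌋)
open import Data.Bool using (Bool; true; false; if_then_else_)
open import Relation.Binary.PropositionalEquality using (_≡_)

-- n ↦ 1/n as a rational (the value at 0 is irrelevant; never used)
recipℕ : ℕ → ℚ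
recipℕ zero    = 0ℚ
recipℕ (suc n) = (+ 1) ℚ./ suc n

-- natural-number division, total (value at divisor 0 irrelevant)
_div′_ : ℕ → ℕ → ℕ
m div′ zero  = 0
m div′ suc n = m / suc n

sumℚ : List ℚ → ℚ
sumℚ = foldr ℚ._+_ 0ℚ

SuperWieferich : ℕ → Set
SuperWieferich p = p ^ 2 ∣ ((2 ^ (p ∸ 1) ∸ 1) div′ p)

-- p-adic digits of a rational p-adic integer x = a/b (p ∤ b).
-- x mod p^k is the unique r ∈ {0,…,p^k - 1} with p^k ∣ a - b r;
-- we find it by search.  Then (x)_j = ⌊ (x mod p^(j+1)) / p^j ⌋.

firstWith : (ℕ → Bool) → List ℕ → ℕ
firstWith P []       = 0
firstWith P (r ∷ rs) = if P r then r else firstWith P rs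

residue : (p k : ℕ) → ℚ → ℕ
residue p k x =
  firstWith (λ r → ⌊ p ^ k ∣? ∣ ↥ x ℤ.- (+ (↧ₙ x)) ℤ.* (+ r) ∣ ⌋) (upTo (p ^ k))

digit : (p : ℕ) → ℚ → (j : ℕ) → ℕ
digit p x j = residue p (suc j) x div′ (p ^ j)

-- Bernoulli numbers via  Σ_{k=0}^{n} C(n+1,k) B_k = 0  (n ≥ 1), B_0 = 1,
-- i.e.  B_n = -1/(n+1) Σ_{k<n} C(n+1,k) B_k.

nextBernoulli : ℕ → List ℚ → ℚ
nextBernoulli zero    _    = 1ℚ
nextBernoulli (suc m) prev =
  ℚ.- (recipℕ (suc (suc m)) ℚ.*
        sumℚ (map (λ { (k , b) → ((+ (suc (suc m) C k)) ℚ./ 1) ℚ.* b })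
                  (zip (upTo (suc m)) prev)))

bernoulliList : ℕ → List ℚ
bernoulliList zero    = []
bernoulliList (suc n) = bernoulliList n ++ [ nextBernoulli n (bernoulliList n) ]

bernoulli : ℕ → ℚ
bernoulli n = nextBernoulli n (bernoulliList n)

agohGiuga : ℕ → ℚ
agohGiuga p = ((((+ p) ℚ./ 1) ℚ.* bernoulli (p ∸ 1)) ℚ.+ 1ℚ) ℚ.* recipℕ p

oddHarmonic : ℕ → ℚ
oddHarmonic p =
  sumℚ (map recipℕ (filter (λ k → k % 2 ≟ 1) (map suc (upTo (p ∸ 2)))))

insertions : ℕ → List ℕ → List (List ℕ)
insertions x []       = [ x ∷ [] ]
insertions x (y ∷ ys) = (x ∷ y ∷ ys) ∷ map (y ∷_) (insertions x ys)

permutations : ℕ → List (List ℕ)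
permutations zero    = [ [] ]
permutations (suc n) = concatMap (insertions (suc n)) (permutations n)

ascents : List ℕ → ℕ
ascents []           = 0
ascents (x ∷ [])     = 0
ascents (x ∷ y ∷ ys) = (if ⌊ x Data.Nat.<? y ⌋ then 1 else 0) + ascents (y ∷ ys)
  where import Data.Nat

evenAscentCount : ℕ → ℕ
evenAscentCount n = length (filter (λ σ → ascents σ % 2 ≟ 0) (permutations n))

module Submission where

-- Write q = (2^(p-1) - 1)/p; condition (a) says p² ∣ q.
--
-- Ascents.  Twice the number of permutations with an even number of ascents is
-- (p-2)! + E, where E is the sum of (-1)^asc over the permutations of p-2 letters.
-- Worpitzky's identity k^n = Σ_σ C(k + asc σ, n), summed over k < p² with signs (-1)^k,
-- gives E ≡ 2^(p-1) O (mod p²), where O is the sum of k^(p-2) over the odd k < p²: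
-- shifting the argument of a binomial coefficient by one flips the sign of the alternating
-- sum, since p² divides C(p² + a, n) for a < n < p.  Doubling k in Σ_{k<p²} k^(p-1) and
-- expanding around p² shows that q and O agree modulo p² up to a p-adic unit.
-- Hence (a) holds iff p² ∣ E.
-- Glaisher's congruence (p-1)! ≡ Σ_{k<p} k^(p-1) - p (mod p²), together with
-- Σ_{k<p} k^(p-1) ≡ p B_{p-1} (mod p²), which follows by comparing the recurrences
-- of power sums and of Bernoulli numbers, translates p² ∣ E into (b).
--
-- Harmonic sum.  The identity Π (1 + p/k) = 2^(p-1), over the odd k < p, expands to
-- q ≡ H' + p e₂ (mod p²), where e₂ is the second elementary symmetric function of the 1/k.
-- By Newton's identity 2 e₂ = H'² - Σ 1/k², and Σ 1/k² ≡ 0 (mod p) for p > 3.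

open import Defs
open import Data.Nat as ℕ using (ℕ; zero; suc; z≤n; s≤s)
import Data.Nat.Divisibility as ℕ
import Data.Nat.DivMod as ℕ
open import Data.Nat.DivMod using (_%_)
open import Data.Nat.Primality using (Prime)
import Data.Nat.Properties as ℕ
open import Data.Product using (_×_; _,_; ∃; proj₁; proj₂)
open import Function using (_∘_)
open import Function.Bundles using (_⇔_; mk⇔; Equivalence)
open import Relation.Binary.PropositionalEquality hiding ([_])
open import Relation.Nullary using (¬_; contradiction; yes; no)

-- The sums run over k < p² rather than k < p because E has to be known modulo p²: for 0 < n < p the
-- index n is a unit modulo p², which puts the full p² into C(p² + a, n) with a < n. A sum of n-th
-- powers leads to the lower index n + 1, so this argument kills power sums up to the exponent p-2.
-- At p-1 the sum T over k < p² is p times a unit, and this failure is exploited: (2^(p-1) - 1) T is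
-- p q times p times a unit, the correction from the expansion is (p-1) p² O, and a congruence
-- modulo p⁴, divided by p², compares q with O modulo p². The shape of (b) comes from (p-2)!. Since
-- p B_{p-1} = p A - 1, Glaisher gives (p-1)! ≡ p A - 1 - p, so (p-2)! ≡ 1 + (2 - A) p and 2 N ≡ 1 +
-- (2 - A) p + E modulo p². Thus (b) prescribes exactly the two digits that 2 N has when E ≡ 0.

module Modular where
  open import Data.Integer using (ℤ; +_; 0ℤ; 1ℤ; _+_; _*_; _-_; -_; _^_)
  open import Data.Integer.Properties
  open import Data.Integer.Divisibility.Signed
  open import Data.Integer.Tactic.RingSolver using (solve-∀)
  open import Level using (0ℓ)
  open import Relation.Binary using (Setoid)

  -- Congruences between integers

  infix 4 _≅_[_]
  record _≅_[_] (a b M : ℤ) : Set where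
    constructor mod
    field ∣diff : M ∣ a - b
  open _≅_[_] public

  ∣-by : ∀ {M a b} → a ≡ b → M ∣ b → M ∣ a
  ∣-by refl d = d

  ∣0 : ∀ M → M ∣ 0ℤ
  ∣0 M = divides 0ℤ refl

  private
    variable
      a b c d M : ℤ

  ≅-reflexive : a ≡ b → a ≅ b [ M ]
  ≅-reflexive {a = a} {M = M} refl = mod (∣-by (+-inverseʳ a) (∣0 M))

  ≅-refl : a ≅ a [ M ]
  ≅-refl = ≅-reflexive refl

  ≅-sym : a ≅ b [ M ] → b ≅ a [ M ]
  ≅-sym {a} {b} (mod d) = mod (∣-by (lem a b) (∣m⇒∣-m d))
    where lem : ∀ a b → b - a ≡ - (a - b)
          lem = solve-∀

  ≅-trans : a ≅ b [ M ] → b ≅ c [ M ] → a ≅ c [ M ]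
  ≅-trans {a} {b} {c = c} (mod d) (mod e) = mod (∣-by (lem a b c) (∣m∣n⇒∣m+n d e))
    where lem : ∀ a b c → a - c ≡ (a - b) + (b - c)
          lem = solve-∀

  ≅-setoid : ℤ → Setoid 0ℓ 0ℓ
  ≅-setoid M = record
    { Carrier = ℤ ; _≈_ = _≅_[ M ]
    ; isEquivalence = record { refl = ≅-refl ; sym = ≅-sym ; trans = ≅-trans } }

  ≅-+ : a ≅ b [ M ] → c ≅ d [ M ] → a + c ≅ b + d [ M ]
  ≅-+ {a} {b} {c = c} {d} (mod x) (mod y) = mod (∣-by (lem a b c d) (∣m∣n⇒∣m+n x y))
    where lem : ∀ a b c d → (a + c) - (b + d) ≡ (a - b) + (c - d)
          lem = solve-∀

  ≅-neg : a ≅ b [ M ] → - a ≅ - b [ M ]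
  ≅-neg {a} {b} (mod x) = mod (∣-by (lem a b) (∣m⇒∣-m x))
    where lem : ∀ a b → (- a) - (- b) ≡ - (a - b)
          lem = solve-∀

  ≅-- : a ≅ b [ M ] → c ≅ d [ M ] → a - c ≅ b - d [ M ]
  ≅-- x y = ≅-+ x (≅-neg y)

  ≅-* : a ≅ b [ M ] → c ≅ d [ M ] → a * c ≅ b * d [ M ]
  ≅-* {a} {b} {c = c} {d} (mod x) (mod y) =
    mod (∣-by (lem a b c d) (∣m∣n⇒∣m+n (∣n⇒∣m*n c x) (∣n⇒∣m*n b y)))
    where lem : ∀ a b c d → a * c - b * d ≡ c * (a - b) + b * (c - d)
          lem = solve-∀

  ≅-*ˡ : ∀ c → a ≅ b [ M ] → c * a ≅ c * b [ M ]
  ≅-*ˡ c = ≅-* (≅-refl {c})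

  ≅-^ : ∀ n → a ≅ b [ M ] → a ^ n ≅ b ^ n [ M ]
  ≅-^ zero    x = ≅-refl
  ≅-^ (suc n) x = ≅-* x (≅-^ n x)

  ∣⇒≅0 : M ∣ a → a ≅ 0ℤ [ M ]
  ∣⇒≅0 {a = a} d = mod (∣-by (+-identityʳ a) d)

  ≅0⇒∣ : a ≅ 0ℤ [ M ] → M ∣ a
  ≅0⇒∣ {a} (mod d) = ∣-by (sym (+-identityʳ a)) d

  ≅-weaken : ∀ {N} → N ∣ M → a ≅ b [ M ] → a ≅ b [ N ]
  ≅-weaken n (mod d) = mod (∣-trans n d)

  ∣-≅ : a ≅ b [ M ] → M ∣ b → M ∣ a
  ∣-≅ e d = ≅0⇒∣ (≅-trans e (∣⇒≅0 d))

  -- The modulus is kept as `y * y` because `y` will be p², a multiple of p, and (p-1)! + 1; in the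
  -- last two cases it is weakened to p² afterwards.
  ^-expand₁ : ∀ x y n → (x + y) ^ suc n ≅ x ^ suc n + + suc n * (x ^ n * y) [ y * y ]
  ^-expand₁ x y zero    = ≅-reflexive (lem x y)
    where lem : ∀ x y → (x + y) * 1ℤ ≡ x * 1ℤ + 1ℤ * (1ℤ * y)
          lem = solve-∀
  ^-expand₁ x y (suc n) = ≅-trans (≅-*ˡ (x + y) (^-expand₁ x y n))
    (mod (divides (+ suc n * x ^ n) (lem x y (x ^ n) (+ suc n))))
    where lem : ∀ x y z s → (x + y) * (x * z + s * (z * y))
                  - (x * (x * z) + (1ℤ + s) * ((x * z) * y)) ≡ (s * z) * (y * y)
          lem = solve-∀

  -- Finite sums and parity

  Σ< : ℕ → (ℕ → ℤ) → ℤ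
  Σ< zero    f = 0ℤ
  Σ< (suc n) f = Σ< n f + f n

  Σ-≅ : ∀ n {f g : ℕ → ℤ} → (∀ k → k ℕ.< n → f k ≅ g k [ M ]) → Σ< n f ≅ Σ< n g [ M ]
  Σ-≅ zero    h = ≅-refl
  Σ-≅ (suc n) h = ≅-+ (Σ-≅ n λ k k<n → h k (ℕ.m<n⇒m<1+n k<n)) (h n ℕ.≤-refl)

  Σ-∣ : ∀ n {f : ℕ → ℤ} → (∀ k → k ℕ.< n → M ∣ f k) → M ∣ Σ< n f
  Σ-∣ {M} zero h = ∣0 M
  Σ-∣ (suc n) h = ∣m∣n⇒∣m+n (Σ-∣ n λ k k<n → h k (ℕ.m<n⇒m<1+n k<n)) (h n ℕ.≤-refl)

  Σ-cong : ∀ n {f g : ℕ → ℤ} → (∀ k → f k ≡ g k) → Σ< n f ≡ Σ< n g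
  Σ-cong zero    h = refl
  Σ-cong (suc n) h = cong₂ _+_ (Σ-cong n h) (h n)

  Σ-+ : ∀ n (f g : ℕ → ℤ) → Σ< n (λ k → f k + g k) ≡ Σ< n f + Σ< n g
  Σ-+ zero    f g = refl
  Σ-+ (suc n) f g = trans (cong (_+ (f n + g n)) (Σ-+ n f g)) (lem (Σ< n f) (Σ< n g) (f n) (g n))
    where lem : ∀ a b c d → a + b + (c + d) ≡ a + c + (b + d)
          lem = solve-∀

  Σ-* : ∀ n c (f : ℕ → ℤ) → Σ< n (λ k → c * f k) ≡ c * Σ< n f
  Σ-* zero    c f = sym (*-zeroʳ c)
  Σ-* (suc n) c f = trans (cong (_+ c * f n) (Σ-* n c f)) (sym (*-distribˡ-+ c _ _))

  Σ-const : ∀ n c → Σ< n (λ _ → c) ≡ + n * c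
  Σ-const zero    c = sym (*-zeroˡ c)
  Σ-const (suc n) c = trans (cong (_+ c) (Σ-const n c)) (lem (+ n) c)
    where lem : ∀ n c → n * c + c ≡ (1ℤ + n) * c
          lem = solve-∀

  Σ-head : ∀ n (f : ℕ → ℤ) → Σ< (suc n) f ≡ f 0 + Σ< n (f ∘ suc)
  Σ-head zero    f = +-comm 0ℤ (f 0)
  Σ-head (suc n) f = trans (cong (_+ f (suc n)) (Σ-head n f)) (+-assoc (f 0) _ _)

  Σ-split : ∀ a b (f : ℕ → ℤ) → Σ< (a ℕ.+ b) f ≡ Σ< a f + Σ< b (λ k → f (a ℕ.+ k))
  Σ-split a zero    f rewrite ℕ.+-identityʳ a = sym (+-identityʳ _)
  Σ-split a (suc b) f rewrite ℕ.+-suc a b =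
    trans (cong (_+ f (a ℕ.+ b)) (Σ-split a b f)) (+-assoc (Σ< a f) _ _)

  Σ-reverse : ∀ n (f : ℕ → ℤ) → Σ< n f ≡ Σ< n (λ k → f (n ℕ.∸ suc k))
  Σ-reverse zero    f = refl
  Σ-reverse (suc n) f = trans (cong (_+ f n) (Σ-reverse n f))
    (trans (+-comm _ (f n)) (sym (Σ-head n (λ k → f (n ℕ.∸ k)))))

  double : ℕ → ℕ
  double zero    = zero
  double (suc n) = suc (suc (double n))

  n+n≡double : ∀ n → n ℕ.+ n ≡ double n
  n+n≡double zero    = refl
  n+n≡double (suc n) = cong suc (trans (ℕ.+-suc n n) (cong suc (n+n≡double n)))

  +double : ∀ n → + double n ≡ + 2 * + n
  +double zero    = refl
  +double (suc n) = trans (cong (λ z → + 2 + z) (+double n)) (lem (+ n))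
    where lem : ∀ n → + 2 + + 2 * n ≡ + 2 * (1ℤ + n)
          lem = solve-∀

  double%2 : ∀ m → double m % 2 ≡ 0
  double%2 zero    = refl
  double%2 (suc m) = double%2 m

  suc-double%2 : ∀ m → suc (double m) % 2 ≡ 1
  suc-double%2 zero    = refl
  suc-double%2 (suc m) = suc-double%2 m

  data Halved : ℕ → Set where
    isDouble    : ∀ m → Halved (double m)
    isSucDouble : ∀ m → Halved (suc (double m))

  halve : ∀ n → Halved n
  halve zero = isDouble 0
  halve (suc n) with halve n
  ... | isDouble m    = isSucDouble m
  ... | isSucDouble m = isDouble (suc m)

  double-+ : ∀ a b → double a ℕ.+ double b ≡ double (a ℕ.+ b)
  double-+ zero    b = refl
  double-+ (suc a) b = cong (suc ∘ suc) (double-+ a b)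

  Σ-even-odd : ∀ m (f : ℕ → ℤ) →
    Σ< (suc (double m)) f ≡ Σ< (suc m) (f ∘ double) + Σ< m (f ∘ suc ∘ double)
  Σ-even-odd zero    f = sym (+-identityʳ _)
  Σ-even-odd (suc m) f = trans
    (cong (λ z → z + f (suc (double m)) + f (double (suc m))) (Σ-even-odd m f))
    (lem (Σ< (suc m) (f ∘ double)) (Σ< m (f ∘ suc ∘ double)) (f (suc (double m))) (f (double (suc m))))
    where lem : ∀ a b c d → a + b + c + d ≡ a + d + (b + c)
          lem = solve-∀

-- Permutations weighted by ascents, Worpitzky's identity, alternating sums

module Eulerian where
  open Modular
  open import Data.Integer using (ℤ; +_; 0ℤ; 1ℤ; -1ℤ; _+_; _*_; _-_; -_; _^_)
  open import Data.Integer.Properties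
  open import Data.Integer.Divisibility.Signed
  open import Data.Integer.Tactic.RingSolver using (solve-∀)
  open import Data.Nat.Combinatorics using (_C_; nCk+nC[k+1]≡[n+1]C[k+1]; k>n⇒nCk≡0)

  -- Eul n g is the sum of g (asc σ) over the permutations σ of n + 1 letters:
  -- a new largest letter can be inserted in 1 + a places without changing the number a of
  -- ascents, and in n - a + 1 places so that it grows by one.
  Eul : ℕ → (ℕ → ℤ) → ℤ
  Eul zero    g = g 0
  Eul (suc n) g = Eul n (λ a → (1ℤ + + a) * g a + (+ suc n - + a) * g (suc a))

  Eul-≅ : ∀ {M} n {g h : ℕ → ℤ} → (∀ a → a ℕ.≤ n → g a ≅ h a [ M ]) → Eul n g ≅ Eul n h [ M ]
  Eul-≅ zero    e = e 0 z≤n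
  Eul-≅ (suc n) e = Eul-≅ n λ a a≤n →
    ≅-+ (≅-*ˡ (1ℤ + + a) (e a (ℕ.m≤n⇒m≤1+n a≤n))) (≅-*ˡ (+ suc n - + a) (e (suc a) (s≤s a≤n)))

  Eul-cong : ∀ n {g h : ℕ → ℤ} → (∀ a → g a ≡ h a) → Eul n g ≡ Eul n h
  Eul-cong zero    e = e 0
  Eul-cong (suc n) e = Eul-cong n λ a →
    cong₂ _+_ (cong ((1ℤ + + a) *_) (e a)) (cong ((+ suc n - + a) *_) (e (suc a)))

  Eul-+ : ∀ n (g h : ℕ → ℤ) → Eul n (λ a → g a + h a) ≡ Eul n g + Eul n h
  Eul-+ zero    g h = refl
  Eul-+ (suc n) g h = trans
    (Eul-cong n λ a → lem (1ℤ + + a) (+ suc n - + a) (g a) (h a) (g (suc a)) (h (suc a)))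
    (Eul-+ n _ _)
    where lem : ∀ x y a b c d → x * (a + b) + y * (c + d) ≡ (x * a + y * c) + (x * b + y * d)
          lem = solve-∀

  Eul-* : ∀ n c (g : ℕ → ℤ) → Eul n (λ a → c * g a) ≡ c * Eul n g
  Eul-* zero    c g = refl
  Eul-* (suc n) c g = trans
    (Eul-cong n λ a → lem (1ℤ + + a) (+ suc n - + a) c (g a) (g (suc a)))
    (Eul-* n c _)
    where lem : ∀ x y c a b → x * (c * a) + y * (c * b) ≡ c * (x * a + y * b)
          lem = solve-∀

  Eul-Σ : ∀ n N (f : ℕ → ℕ → ℤ) → Eul n (λ a → Σ< N (λ k → f k a)) ≡ Σ< N (λ k → Eul n (f k))
  Eul-Σ n zero    f = trans (Eul-* n 0ℤ (λ _ → 0ℤ)) (*-zeroˡ (Eul n (λ _ → 0ℤ)))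
  Eul-Σ n (suc N) f = trans (Eul-+ n _ (f N)) (cong (_+ Eul n (f N)) (Eul-Σ n N f))

  factorial : ℕ → ℤ
  factorial zero    = 1ℤ
  factorial (suc n) = + suc n * factorial n

  -- The two weights `1ℤ + + a` and `+ suc n - + a` add up to n + 2 whatever `a` is, so each
  -- insertion contributes one factor of the factorial.
  Eul-1 : ∀ n c → Eul n (λ _ → c) ≡ c * factorial (suc n)
  Eul-1 zero    c = sym (*-identityʳ c)
  Eul-1 (suc n) c = trans
    (trans (Eul-cong n λ a → lem (+ a) (+ n) c) (Eul-1 n (+ suc (suc n) * c)))
    (lem′ (+ suc (suc n)) c (factorial (suc n)))
    where lem : ∀ a n c → (1ℤ + a) * c + ((1ℤ + n) - a) * c ≡ (1ℤ + (1ℤ + n)) * c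
          lem = solve-∀
          lem′ : ∀ s c f → s * c * f ≡ c * (s * f)
          lem′ = solve-∀

  infix 9 _choose_
  _choose_ : ℕ → ℕ → ℤ
  n choose k = + (n C k)

  pascal : ∀ n k → suc n choose suc k ≡ n choose k + n choose suc k
  pascal n k = cong +_ (sym (nCk+nC[k+1]≡[n+1]C[k+1] n k))

  choose-0 : ∀ n → n choose 0 ≡ 1ℤ
  choose-0 zero = refl
  choose-0 (suc n) = refl

  choose-> : ∀ {n k} → n ℕ.< k → n choose k ≡ 0ℤ
  choose-> n<k = cong +_ (k>n⇒nCk≡0 n<k)

  -- The two absorption identities feed each other: each follows from the other or from Pascal's
  -- rule at a smaller `n`. With the integer factor `+ n - + k` no bound on `k` is needed, since
  -- both sides vanish for k ≥ n.
  choose-absorb : ∀ n k → + suc k * n choose suc k ≡ (+ n - + k) * n choose k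
  suc-choose-absorb : ∀ n k → + suc k * suc n choose suc k ≡ + suc n * n choose k

  choose-absorb zero    zero    = refl
  choose-absorb zero    (suc k) = trans (cong (+ suc (suc k) *_) (choose-> {0} {suc (suc k)} (s≤s z≤n)))
    (trans (*-zeroʳ (+ suc (suc k))) (trans (sym (*-zeroʳ (+ 0 - + suc k)))
      (cong ((+ 0 - + suc k) *_) (sym (choose-> {0} {suc k} (s≤s z≤n))))))
  choose-absorb (suc n) zero    = trans (suc-choose-absorb n 0) (trans
    (cong (+ suc n *_) (trans (choose-0 n) (sym (choose-0 (suc n)))))
    (cong (_* suc n choose 0) (sym (+-identityʳ (+ suc n)))))
  choose-absorb (suc n) (suc k) = begin
    + suc (suc k) * suc n choose suc (suc k)
      ≡⟨ suc-choose-absorb n (suc k) ⟩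
    (1ℤ + + n) * c
      ≡⟨ lem (+ n) (+ k) c ⟩
    (1ℤ + + k) * c + (+ n - + k) * c
      ≡⟨ cong (_+ (+ n - + k) * c) (choose-absorb n k) ⟩
    (+ n - + k) * n choose k + (+ n - + k) * c
      ≡⟨ lem′ (+ n) (+ k) (n choose k) c ⟩
    (1ℤ + + n - (1ℤ + + k)) * (n choose k + c)
      ≡⟨ cong ((1ℤ + + n - (1ℤ + + k)) *_) (pascal n k) ⟨
    (+ suc n - + suc k) * suc n choose suc k ∎
    where
    open ≡-Reasoning
    c = n choose suc k
    lem : ∀ n k c → (1ℤ + n) * c ≡ (1ℤ + k) * c + (n - k) * c
    lem = solve-∀
    lem′ : ∀ n k b c → (n - k) * b + (n - k) * c ≡ (1ℤ + n - (1ℤ + k)) * (b + c)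
    lem′ = solve-∀

  suc-choose-absorb n k = begin
    + suc k * suc n choose suc k
      ≡⟨ cong (+ suc k *_) (pascal n k) ⟩
    + suc k * (n choose k + n choose suc k)
      ≡⟨ *-distribˡ-+ (+ suc k) (n choose k) (n choose suc k) ⟩
    + suc k * n choose k + + suc k * n choose suc k
      ≡⟨ cong (λ z → + suc k * n choose k + z) (choose-absorb n k) ⟩
    (1ℤ + + k) * n choose k + (+ n - + k) * n choose k
      ≡⟨ lem (+ n) (+ k) (n choose k) ⟩
    + suc n * n choose k ∎
    where
    open ≡-Reasoning
    lem : ∀ n k c → (1ℤ + k) * c + (n - k) * c ≡ (1ℤ + n) * c
    lem = solve-∀

  -- One insertion step takes the function with lower index N + 1 to `x` times the function with
  -- lower index N: after Pascal and absorption the coefficient of C(x + a, N) is (x + a - N) + (N -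
  -- a) = x.
  worpitzky : ∀ x n → Eul n (λ a → (x ℕ.+ a) choose suc n) ≡ (+ x) ^ suc n
  worpitzky x zero rewrite ℕ.+-identityʳ x = begin
    x choose 1                    ≡⟨ *-identityˡ (x choose 1) ⟨
    1ℤ * x choose 1               ≡⟨ choose-absorb x 0 ⟩
    (+ x - 0ℤ) * x choose 0       ≡⟨ cong₂ _*_ (+-identityʳ (+ x)) (choose-0 x) ⟩
    + x * 1ℤ                      ∎
    where open ≡-Reasoning
  worpitzky x (suc n) = begin
    Eul n (λ a → (1ℤ + + a) * (x ℕ.+ a) choose suc N + (+ N - + a) * (x ℕ.+ suc a) choose suc N)
      ≡⟨ Eul-cong n step ⟩
    Eul n (λ a → + x * (x ℕ.+ a) choose N)
      ≡⟨ Eul-* n (+ x) _ ⟩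
    + x * Eul n (λ a → (x ℕ.+ a) choose N)
      ≡⟨ cong (+ x *_) (worpitzky x n) ⟩
    (+ x) ^ suc N ∎
    where
    open ≡-Reasoning
    N = suc n
    lem : ∀ a n b c → (1ℤ + a) * c + (n - a) * (b + c) ≡ (1ℤ + n) * c + (n - a) * b
    lem = solve-∀
    lem′ : ∀ x a n b → (x + a - n) * b + (n - a) * b ≡ x * b
    lem′ = solve-∀
    step : ∀ a → (1ℤ + + a) * (x ℕ.+ a) choose suc N + (+ N - + a) * (x ℕ.+ suc a) choose suc N
               ≡ + x * (x ℕ.+ a) choose N
    step a rewrite ℕ.+-suc x a = begin
      (1ℤ + + a) * c + (+ N - + a) * suc y choose suc N
        ≡⟨ cong (λ z → (1ℤ + + a) * c + (+ N - + a) * z) (pascal y N) ⟩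
      (1ℤ + + a) * c + (+ N - + a) * (b + c)
        ≡⟨ lem (+ a) (+ N) b c ⟩
      (1ℤ + + N) * c + (+ N - + a) * b
        ≡⟨ cong (_+ (+ N - + a) * b) (choose-absorb y N) ⟩
      (+ y - + N) * b + (+ N - + a) * b
        ≡⟨ lem′ (+ x) (+ a) (+ N) b ⟩
      + x * b ∎
      where
      y = x ℕ.+ a
      b = y choose N
      c = y choose suc N

  powerSum : ℕ → ℕ → ℤ
  powerSum n N = Σ< N (λ k → (+ k) ^ n)

  hockey-stick : ∀ N a n → Σ< N (λ k → (k ℕ.+ a) choose n) + a choose suc n ≡ (N ℕ.+ a) choose suc n
  hockey-stick zero    a n = +-identityˡ _
  hockey-stick (suc N) a n = begin
    Σ< N f + (N ℕ.+ a) choose n + a choose suc n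
      ≡⟨ lem (Σ< N f) ((N ℕ.+ a) choose n) (a choose suc n) ⟩
    (N ℕ.+ a) choose n + (Σ< N f + a choose suc n)
      ≡⟨ cong (λ z → (N ℕ.+ a) choose n + z) (hockey-stick N a n) ⟩
    (N ℕ.+ a) choose n + (N ℕ.+ a) choose suc n
      ≡⟨ pascal (N ℕ.+ a) n ⟨
    (suc N ℕ.+ a) choose suc n ∎
    where
    open ≡-Reasoning
    f = λ k → (k ℕ.+ a) choose n
    lem : ∀ s b c → s + b + c ≡ b + (s + c)
    lem = solve-∀

  -- Worpitzky summed over x < N. This is really an equality, but the boundary term
  -- `a choose suc (suc n)` vanishes only for a ≤ n, a bound that `Eul-≅` provides and `Eul-cong`
  -- does not; hence the arbitrary modulus.
  powerSum-choose : ∀ M N n → powerSum (suc n) N ≅ Eul n (λ a → (N ℕ.+ a) choose suc (suc n)) [ M ]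
  powerSum-choose M N n = begin
    Σ< N (λ k → (+ k) ^ suc n)
      ≡⟨ Σ-cong N (λ k → worpitzky k n) ⟨
    Σ< N (λ k → Eul n (λ a → (k ℕ.+ a) choose suc n))
      ≡⟨ Eul-Σ n N (λ k a → (k ℕ.+ a) choose suc n) ⟨
    Eul n (λ a → Σ< N (λ k → (k ℕ.+ a) choose suc n))
      ≈⟨ Eul-≅ n (λ a a≤n → ≅-reflexive (step a a≤n)) ⟩
    Eul n (λ a → (N ℕ.+ a) choose suc (suc n)) ∎
    where
    open import Relation.Binary.Reasoning.Setoid (≅-setoid M)
    step : ∀ a → a ℕ.≤ n → Σ< N (λ k → (k ℕ.+ a) choose suc n) ≡ (N ℕ.+ a) choose suc (suc n)
    step a a≤n = trans (sym (+-identityʳ _)) (trans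
      (cong (λ z → Σ< N (λ k → (k ℕ.+ a) choose suc n) + z) (sym (choose-> (ℕ.m≤n⇒m≤1+n (s≤s a≤n)))))
      (hockey-stick N a (suc n)))

  sgn : ℕ → ℤ
  sgn zero    = 1ℤ
  sgn (suc n) = - sgn n

  sgn-double : ∀ m → sgn (double m) ≡ 1ℤ
  sgn-double zero    = refl
  sgn-double (suc m) = trans (neg-involutive _) (sgn-double m)

  Alt : ℕ → (ℕ → ℤ) → ℤ
  Alt n f = Σ< n (λ k → sgn k * f k)

  -- Moving the argument by one moves every term to the opposite sign; only the two ends fail to
  -- cancel.
  Alt-shift : ∀ n (f : ℕ → ℤ) → Alt n (f ∘ suc) ≡ f 0 - sgn n * f n - Alt n f
  Alt-shift zero    f = lem (f 0)
    where lem : ∀ a → 0ℤ ≡ a - 1ℤ * a - 0ℤ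
          lem = solve-∀
  Alt-shift (suc n) f = trans (cong (_+ sgn n * f (suc n)) (Alt-shift n f))
    (lem (f 0) (sgn n) (f n) (f (suc n)) (Alt n f))
    where lem : ∀ z s a b t → z - s * a - t + s * b ≡ z - (- s) * b - (t + s * a)
          lem = solve-∀

  -- Trades the signs for a full power sum, which will vanish modulo p², and the sum over odd
  -- numbers.
  Alt-odd : ∀ m (f : ℕ → ℤ) →
    Alt (suc (double m)) f ≡ Σ< (suc (double m)) f - + 2 * Σ< m (f ∘ suc ∘ double)
  Alt-odd m f = begin
    Alt (suc (double m)) f
      ≡⟨ Σ-even-odd m (λ k → sgn k * f k) ⟩
    Σ< (suc m) (λ i → sgn (double i) * f (double i))
      + Σ< m (λ i → - sgn (double i) * f (suc (double i)))
      ≡⟨ cong₂ _+_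
           (Σ-cong (suc m) λ i → trans (cong (_* f (double i)) (sgn-double i)) (*-identityˡ _))
           (trans (Σ-cong m λ i → cong (λ s → - s * f (suc (double i))) (sgn-double i)) (Σ-* m -1ℤ _)) ⟩
    Σ< (suc m) (f ∘ double) + -1ℤ * o
      ≡⟨ lem (Σ< (suc m) (f ∘ double)) o ⟩
    (Σ< (suc m) (f ∘ double) + o) - + 2 * o
      ≡⟨ cong (_- + 2 * o) (Σ-even-odd m f) ⟨
    Σ< (suc (double m)) f - + 2 * o ∎
    where
    open ≡-Reasoning
    o = Σ< m (f ∘ suc ∘ double)
    lem : ∀ e o → e + -1ℤ * o ≡ (e + o) - + 2 * o
    lem = solve-∀

  -- Here M will be p or p², so that each 0 < k < p is invertible modulo M.
  module UnitsBelow (p M : ℕ) {{_ : ℕ.NonZero M}}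
    (unit : ∀ k x → suc k ℕ.< p → + M ∣ + suc k * x → + M ∣ x) where

    -- For a = 0, absorption gives n C(M, n) = M C(M - 1, n - 1) with `n` a unit. Pascal then raises
    -- `a`; the condition a < n keeps the lower index positive throughout.
    ∣choose : ∀ a n → a ℕ.< n → n ℕ.< p → + M ∣ (M ℕ.+ a) choose n
    ∣choose zero (suc n) _ n<p = subst (λ z → + M ∣ z choose suc n) (sym (ℕ.+-identityʳ M))
      (unit n _ n<p (subst (λ m → + M ∣ + suc n * m choose suc n) (ℕ.suc-pred M)
        (∣-by (suc-choose-absorb (ℕ.pred M) n)
          (∣m⇒∣m*n (ℕ.pred M choose n) (∣-reflexive (cong +_ (sym (ℕ.suc-pred M))))))))
    ∣choose (suc a) (suc n) (s≤s a<n) n<p = subst (λ z → + M ∣ z choose suc n) (sym (ℕ.+-suc M a))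
      (∣-by (pascal (M ℕ.+ a) n) (∣m∣n⇒∣m+n
        (∣choose a n a<n (ℕ.<-trans (ℕ.n<1+n n) n<p))
        (∣choose a (suc n) (ℕ.m<n⇒m<1+n a<n) n<p)))

    ∣powerSum : ∀ n → suc (suc n) ℕ.< p → + M ∣ powerSum (suc n) M
    ∣powerSum n 2+n<p = ∣-≅ (powerSum-choose (+ M) M n)
      (≅0⇒∣ (≅-trans (Eul-≅ n {h = λ _ → 0ℤ} λ a a≤n → ∣⇒≅0 (∣choose a (suc (suc n)) (ℕ.m≤n⇒m≤1+n (s≤s a≤n)) 2+n<p))
        (≅-reflexive (trans (Eul-1 n 0ℤ) (*-zeroˡ (factorial (suc n)))))))

    module OddModulus (sgnM : sgn M ≡ -1ℤ) where

      Alt-shift-≅ : ∀ f → Alt M (f ∘ suc) ≅ f 0 + f M - Alt M f [ + M ]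
      Alt-shift-≅ f = ≅-reflexive (trans (Alt-shift M f)
        (trans (cong (λ s → f 0 - s * f M - Alt M f) sgnM) (lem (f 0) (f M) (Alt M f))))
        where lem : ∀ a b t → a - -1ℤ * b - t ≡ a + b - t
              lem = solve-∀

      -- By Pascal, the sum for C(k, n) is the shifted sum for C(k, n + 1) minus the unshifted one.
      -- The shift only changes the sign, so raising `n` by one divides the sum by -2.
      Alt-choose : ∀ n → n ℕ.< p → (- + 2) ^ n * Alt M (λ k → k choose n) ≅ 1ℤ [ + M ]
      Alt-choose zero _ = ≅-reflexive (begin
        1ℤ * Alt M (λ k → k choose 0)
          ≡⟨ *-identityˡ _ ⟩
        Alt M (λ k → k choose 0)
          ≡⟨ Σ-cong M (λ k → cong (sgn k *_) (choose-0 k)) ⟩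
        Alt M (λ _ → 1ℤ)
          -- For a constant the shift identity reads t = 1 + 1 - t.
          ≡⟨ lem (Alt M (λ _ → 1ℤ)) (sgn M) (Alt-shift M (λ _ → 1ℤ)) sgnM ⟩
        1ℤ ∎)
        where
        open ≡-Reasoning
        twice : ∀ t → + 2 * t ≡ t + t
        twice = solve-∀
        lem′ : ∀ t → (1ℤ - -1ℤ * 1ℤ - t) + t ≡ + 2 * 1ℤ
        lem′ = solve-∀
        lem : ∀ t s → t ≡ 1ℤ - s * 1ℤ - t → s ≡ -1ℤ → t ≡ 1ℤ
        lem t _ e refl = *-cancelˡ-≡ (+ 2) t 1ℤ (trans (twice t) (trans (cong (_+ t) e) (lem′ t)))
      Alt-choose (suc n) n<p = ≅-trans
        (≅-trans (≅-reflexive (lem ((- + 2) ^ n) (Alt M f)))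
          (≅-*ˡ ((- + 2) ^ n) (≅-sym step)))
        (Alt-choose n (ℕ.<-trans (ℕ.n<1+n n) n<p))
        where
        open import Relation.Binary.Reasoning.Setoid (≅-setoid (+ M))
        f = λ k → k choose suc n
        g = λ k → k choose n
        lem : ∀ c t → (- + 2) * c * t ≡ c * ((- + 2) * t)
        lem = solve-∀
        lem₁ : ∀ a b → a ≡ (a + b) - b
        lem₁ = solve-∀
        lem₂ : ∀ t → 0ℤ + 0ℤ - t - t ≡ (- + 2) * t
        lem₂ = solve-∀
        step : Alt M g ≅ (- + 2) * Alt M f [ + M ]
        step = begin
          Alt M g                        ≡⟨ lem₁ (Alt M g) (Alt M f) ⟩
          (Alt M g + Alt M f) - Alt M f  ≡⟨ cong (_- Alt M f) (Σ-+ M _ _) ⟨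
          Σ< M (λ k → sgn k * g k + sgn k * f k) - Alt M f
            ≡⟨ cong (_- Alt M f) (Σ-cong M λ k → trans (sym (*-distribˡ-+ (sgn k) (g k) (f k)))
                                                    (cong (sgn k *_) (sym (pascal k n)))) ⟩
          Alt M (f ∘ suc) - Alt M f      ≈⟨ ≅-- (Alt-shift-≅ f) ≅-refl ⟩
          (f 0 + f M - Alt M f) - Alt M f
            ≈⟨ ≅-- (≅-- (≅-+
                 (≅-reflexive (choose-> {0} {suc n} (s≤s z≤n)))
                 (∣⇒≅0 (subst (λ z → + M ∣ z choose suc n) (ℕ.+-identityʳ M) (∣choose 0 (suc n) (s≤s z≤n) n<p))))
                 (≅-refl {Alt M f})) (≅-refl {Alt M f}) ⟩
          0ℤ + 0ℤ - Alt M f - Alt M f    ≡⟨ lem₂ (Alt M f) ⟩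
          (- + 2) * Alt M f              ∎

      Alt-choose-shift : ∀ a n → a ℕ.< n → n ℕ.< p →
        Alt M (λ k → (k ℕ.+ a) choose n) ≅ sgn a * Alt M (λ k → k choose n) [ + M ]
      Alt-choose-shift zero n _ _ = ≅-reflexive (trans
        (Σ-cong M λ k → cong (λ z → sgn k * z choose n) (ℕ.+-identityʳ k)) (sym (*-identityˡ _)))
      Alt-choose-shift (suc a) n a<n n<p = begin
        Alt M (λ k → (k ℕ.+ suc a) choose n)
          ≡⟨ Σ-cong M (λ k → cong (λ z → sgn k * z choose n) (ℕ.+-suc k a)) ⟩
        Alt M (f ∘ suc)                ≈⟨ Alt-shift-≅ f ⟩
        f 0 + f M - Alt M f
          ≈⟨ ≅-- (≅-+ (≅-reflexive (choose-> a<n′)) (∣⇒≅0 (∣choose a n a<n′ n<p))) (Alt-choose-shift a n a<n′ n<p) ⟩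
        0ℤ + 0ℤ - sgn a * b            ≡⟨ lem (sgn a) b ⟩
        - sgn a * b                    ∎
        where
        open import Relation.Binary.Reasoning.Setoid (≅-setoid (+ M))
        f = λ k → (k ℕ.+ a) choose n
        b = Alt M (λ k → k choose n)
        a<n′ : a ℕ.< n
        a<n′ = ℕ.<-trans (ℕ.n<1+n a) a<n
        lem : ∀ s b → 0ℤ + 0ℤ - s * b ≡ - s * b
        lem = solve-∀

      -- In Worpitzky's identity the number of ascents enters only as a shift of the argument, and
      -- each shift is a sign. So the alternating sum of powers is `Eul n sgn` times the unshifted
      -- sum `b`, whose inverse is the power of -2.
      Alt-power : ∀ n → suc n ℕ.< p →
        (- + 2) ^ suc n * Alt M (λ k → (+ k) ^ suc n) ≅ Eul n sgn [ + M ]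
      Alt-power n n<p = begin
        c * Alt M (λ k → (+ k) ^ suc n)
          ≡⟨ cong (c *_) (Σ-cong M λ k → trans (cong (sgn k *_) (sym (worpitzky k n))) (sym (Eul-* n (sgn k) _))) ⟩
        c * Σ< M (λ k → Eul n (λ a → sgn k * (k ℕ.+ a) choose suc n))
          ≡⟨ cong (c *_) (Eul-Σ n M (λ k a → sgn k * (k ℕ.+ a) choose suc n)) ⟨
        c * Eul n (λ a → Alt M (λ k → (k ℕ.+ a) choose suc n))
          ≈⟨ ≅-*ˡ c (Eul-≅ n λ a a≤n → ≅-trans (Alt-choose-shift a (suc n) (s≤s a≤n) n<p) (≅-reflexive (*-comm (sgn a) b))) ⟩
        c * Eul n (λ a → b * sgn a)    ≡⟨ cong (c *_) (Eul-* n b sgn) ⟩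
        c * (b * Eul n sgn)            ≡⟨ *-assoc c b _ ⟨
        c * b * Eul n sgn              ≈⟨ ≅-* (Alt-choose (suc n) n<p) ≅-refl ⟩
        1ℤ * Eul n sgn                 ≡⟨ *-identityˡ _ ⟩
        Eul n sgn                      ∎
        where
        open import Relation.Binary.Reasoning.Setoid (≅-setoid (+ M))
        c = (- + 2) ^ suc n
        b = Alt M (λ k → k choose suc n)

-- Power sums, doubling, Fermat's congruence

module PowerSums where
  open Modular
  open Eulerian
  open import Data.Integer using (ℤ; +_; 0ℤ; 1ℤ; -1ℤ; _+_; _*_; _-_; -_; _^_; ∣_∣)
  open import Data.Integer.Properties
  open import Data.Integer.Divisibility.Signed
  open import Data.Integer.Tactic.RingSolver using (solve-∀)
  open import Data.Nat.Combinatorics using (nCn≡1)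
  open import Data.Nat.Primality using (euclidsLemma; prime⇒nonZero; prime⇒nonTrivial)
  open import Data.Sum using (inj₁; inj₂)

  ∣∣⇒*∣* : ∀ {a b x y} → a ∣ x → b ∣ y → a * b ∣ x * y
  ∣∣⇒*∣* {a} {b} (divides u refl) (divides v refl) = divides (u * v) (lem u a v b)
    where lem : ∀ u a v b → (u * a) * (v * b) ≡ (u * v) * (a * b)
          lem = solve-∀

  ^-distribʳ-* : ∀ a b n → (a * b) ^ n ≡ a ^ n * b ^ n
  ^-distribʳ-* a b zero    = refl
  ^-distribʳ-* a b (suc n) = trans (cong (a * b *_) (^-distribʳ-* a b n)) (lem a b (a ^ n) (b ^ n))
    where lem : ∀ a b c d → a * b * (c * d) ≡ a * c * (b * d)
          lem = solve-∀

  binomial : ∀ n x → Σ< (suc n) (λ j → n choose j * x ^ j) ≡ (1ℤ + x) ^ n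
  binomial zero    x = refl
  binomial (suc n) x = begin
    Σ< (suc (suc n)) (λ j → suc n choose j * x ^ j)
      ≡⟨ Σ-head (suc n) (λ j → suc n choose j * x ^ j) ⟩
    1ℤ + Σ< (suc n) (λ j → suc n choose suc j * (x * x ^ j))
      ≡⟨ cong (λ z → 1ℤ + z) (Σ-cong (suc n) λ j → trans (cong (_* (x * x ^ j)) (pascal n j)) (lem (n choose j) (n choose suc j) x (x ^ j))) ⟩
    1ℤ + Σ< (suc n) (λ j → x * (n choose j * x ^ j) + n choose suc j * (x * x ^ j))
      ≡⟨ cong (λ z → 1ℤ + z) (Σ-+ (suc n) (λ j → x * (n choose j * x ^ j)) (λ j → n choose suc j * (x * x ^ j))) ⟩
    1ℤ + (Σ< (suc n) (λ j → x * (n choose j * x ^ j)) + Σ< (suc n) (λ j → n choose suc j * (x * x ^ j)))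
      ≡⟨ lem′ (Σ< (suc n) (λ j → x * (n choose j * x ^ j))) (Σ< (suc n) (λ j → n choose suc j * (x * x ^ j))) ⟩
    Σ< (suc n) (λ j → x * (n choose j * x ^ j)) + (1ℤ + Σ< (suc n) (λ j → n choose suc j * (x * x ^ j)))
      ≡⟨ cong₂ _+_ (trans (Σ-* (suc n) x (λ j → n choose j * x ^ j)) (cong (x *_) (binomial n x))) tail ⟩
    x * (1ℤ + x) ^ n + (1ℤ + x) ^ n
      ≡⟨ lem″ x ((1ℤ + x) ^ n) ⟩
    (1ℤ + x) ^ suc n ∎
    where
    open ≡-Reasoning
    lem : ∀ a b x y → (a + b) * (x * y) ≡ x * (a * y) + b * (x * y)
    lem = solve-∀
    lem′ : ∀ a b → 1ℤ + (a + b) ≡ a + (1ℤ + b)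
    lem′ = solve-∀
    lem″ : ∀ x y → x * y + y ≡ (1ℤ + x) * y
    lem″ = solve-∀
    tail : 1ℤ + Σ< (suc n) (λ j → n choose suc j * (x * x ^ j)) ≡ (1ℤ + x) ^ n
    tail = begin
      1ℤ + Σ< (suc n) (λ j → n choose suc j * (x * x ^ j))
        ≡⟨ cong (λ c → c * 1ℤ + Σ< (suc n) (λ j → n choose suc j * (x * x ^ j))) (choose-0 n) ⟨
      n choose 0 * 1ℤ + Σ< (suc n) (λ j → n choose suc j * (x * x ^ j))
        ≡⟨ Σ-head (suc n) (λ j → n choose j * x ^ j) ⟨
      Σ< (suc n) (λ j → n choose j * x ^ j) + n choose suc n * x ^ suc n
        ≡⟨ cong₂ (λ a c → a + c * x ^ suc n) (binomial n x) (choose-> (ℕ.n<1+n n)) ⟩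
      (1ℤ + x) ^ n + 0ℤ * x ^ suc n
        ≡⟨ trans (cong (λ z → (1ℤ + x) ^ n + z) (*-zeroˡ (x ^ suc n))) (+-identityʳ _) ⟩
      (1ℤ + x) ^ n ∎

  -- Telescoping in `N`: the increment is (N + 1)^(n+1) - N^(n+1), the binomial expansion without
  -- its top term. Besides Fermat's congruence it yields the comparison with Bernoulli numbers,
  -- which satisfy the same recurrence with right side 0.
  Σ-choose-powerSum : ∀ n N → Σ< (suc n) (λ j → suc n choose j * powerSum j N) ≡ (+ N) ^ suc n
  Σ-choose-powerSum n zero    = trans (Σ-cong (suc n) λ j → *-zeroʳ (suc n choose j))
    (trans (Σ-const (suc n) 0ℤ) (*-zeroʳ (+ suc n)))
  Σ-choose-powerSum n (suc N) = begin
    Σ< (suc n) (λ j → suc n choose j * (powerSum j N + (+ N) ^ j))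
      ≡⟨ Σ-cong (suc n) (λ j → *-distribˡ-+ (suc n choose j) (powerSum j N) ((+ N) ^ j)) ⟩
    Σ< (suc n) (λ j → suc n choose j * powerSum j N + suc n choose j * (+ N) ^ j)
      ≡⟨ Σ-+ (suc n) (λ j → suc n choose j * powerSum j N) (λ j → suc n choose j * (+ N) ^ j) ⟩
    Σ< (suc n) (λ j → suc n choose j * powerSum j N) + t
      ≡⟨ cong (_+ t) (Σ-choose-powerSum n N) ⟩
    (+ N) ^ suc n + t
      ≡⟨ lem ((+ N) ^ suc n) t ⟩
    t + 1ℤ * (+ N) ^ suc n
      ≡⟨ cong (λ c → t + c * (+ N) ^ suc n) (cong +_ (nCn≡1 (suc n))) ⟨
    t + suc n choose suc n * (+ N) ^ suc n
      ≡⟨ binomial (suc n) (+ N) ⟩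
    (+ suc N) ^ suc n ∎
    where
    open ≡-Reasoning
    t = Σ< (suc n) (λ j → suc n choose j * (+ N) ^ j)
    lem : ∀ a t → a + t ≡ t + 1ℤ * a
    lem = solve-∀

  -- 2 k ranges over the even numbers below M and over M + (odd number below M).
  doubled-powerSum : ∀ m n → let M = suc (double m) in
    (+ 2) ^ suc n * powerSum (suc n) M
      ≅ powerSum (suc n) M + + suc n * + M * Σ< m (λ i → (+ suc (double i)) ^ n) [ + M * + M ]
  doubled-powerSum m n = begin
    (+ 2) ^ suc n * powerSum (suc n) M
      ≡⟨ Σ-* M ((+ 2) ^ suc n) (λ k → (+ k) ^ suc n) ⟨
    Σ< M (λ k → (+ 2) ^ suc n * (+ k) ^ suc n)
      ≡⟨ Σ-cong M (λ k → trans (sym (^-distribʳ-* (+ 2) (+ k) (suc n))) (cong (_^ suc n) (sym (+double k)))) ⟩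
    Σ< M (λ k → (+ double k) ^ suc n)
      ≡⟨ cong (λ z → Σ< z (λ k → (+ double k) ^ suc n)) M≡ ⟩
    Σ< (suc m ℕ.+ m) (λ k → (+ double k) ^ suc n)
      ≡⟨ Σ-split (suc m) m (λ k → (+ double k) ^ suc n) ⟩
    evens + Σ< m (λ k → (+ double (suc m ℕ.+ k)) ^ suc n)
      ≈⟨ ≅-+ (≅-refl {evens}) (Σ-≅ m λ k _ → ≅-trans (≅-reflexive (cong (_^ suc n) (shift k))) (^-expand₁ (odd k) (+ M) n)) ⟩
    evens + Σ< m (λ k → odd k ^ suc n + + suc n * (odd k ^ n * + M))
      ≡⟨ cong (λ z → evens + z) (Σ-+ m (λ k → odd k ^ suc n) (λ k → + suc n * (odd k ^ n * + M))) ⟩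
    evens + (odds + Σ< m (λ k → + suc n * (odd k ^ n * + M)))
      ≡⟨ cong (λ z → evens + (odds + z)) (trans (Σ-cong m λ k → lem (+ suc n) (odd k ^ n) (+ M)) (Σ-* m (+ suc n * + M) (λ k → odd k ^ n))) ⟩
    evens + (odds + + suc n * + M * Σ< m (λ k → odd k ^ n))
      ≡⟨ +-assoc evens odds _ ⟨
    evens + odds + + suc n * + M * Σ< m (λ k → odd k ^ n)
      ≡⟨ cong (_+ + suc n * + M * Σ< m (λ k → odd k ^ n)) (Σ-even-odd m (λ k → (+ k) ^ suc n)) ⟨
    powerSum (suc n) M + + suc n * + M * Σ< m (λ k → odd k ^ n) ∎
    where
    M = suc (double m)
    open import Relation.Binary.Reasoning.Setoid (≅-setoid (+ M * + M))
    odd : ℕ → ℤ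
    odd k = + suc (double k)
    evens = Σ< (suc m) (λ k → (+ double k) ^ suc n)
    odds = Σ< m (λ k → odd k ^ suc n)
    lem : ∀ a b c → a * (b * c) ≡ a * c * b
    lem = solve-∀
    M≡ : M ≡ suc m ℕ.+ m
    M≡ = cong suc (sym (n+n≡double m))
    shift : ∀ k → + double (suc m ℕ.+ k) ≡ odd k + + M
    shift k = trans (+double (suc m ℕ.+ k)) (trans (lem′ (+ m) (+ k))
      (sym (cong₂ (λ a b → (1ℤ + a) + (1ℤ + b)) (+double k) (+double m))))
      where lem′ : ∀ m k → + 2 * (1ℤ + m + k) ≡ (1ℤ + + 2 * k) + (1ℤ + + 2 * m)
            lem′ = solve-∀

  module PrimeModulus (p : ℕ) (p-prime : Prime p) where

    P : ℤ
    P = + p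

    instance
      p-nonZero : ℕ.NonZero p
      p-nonZero = prime⇒nonZero p-prime

    1<p : 1 ℕ.< p
    1<p = ℕ.nonTrivial⇒n>1 p {{prime⇒nonTrivial p-prime}}

    P∣*⇒P∣ : ∀ {a b} → ¬ P ∣ a → P ∣ a * b → P ∣ b
    P∣*⇒P∣ {a} {b} ∤a d with euclidsLemma ∣ a ∣ ∣ b ∣ p-prime (subst (p ℕ.∣_) (abs-* a b) (∣⇒∣ᵤ d))
    ... | inj₁ ∣a = contradiction (∣ᵤ⇒∣ ∣a) ∤a
    ... | inj₂ ∣b = ∣ᵤ⇒∣ ∣b

    P²∣*⇒P²∣ : ∀ {a b} → ¬ P ∣ a → P * P ∣ a * b → P * P ∣ b
    P²∣*⇒P²∣ {a} {b} ∤a d with P∣*⇒P∣ {a} {b} ∤a (∣-trans (∣m⇒∣m*n P ∣-refl) d)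
    ... | divides c refl = *-monoˡ-∣ P (P∣*⇒P∣ ∤a (*-cancelʳ-∣ P (∣-by (*-assoc a c P) d)))

    ∤-* : ∀ {a b} → ¬ P ∣ a → ¬ P ∣ b → ¬ P ∣ a * b
    ∤-* ∤a ∤b d = ∤b (P∣*⇒P∣ ∤a d)

    ∤1 : ¬ P ∣ 1ℤ
    ∤1 d = ℕ.<⇒≱ 1<p (ℕ.∣⇒≤ (∣⇒∣ᵤ d))

    ∤-1 : ¬ P ∣ -1ℤ
    ∤-1 d = ∤1 (∣m⇒∣-m d)

    ∤-^ : ∀ {a} n → ¬ P ∣ a → ¬ P ∣ a ^ n
    ∤-^ zero    ∤a = ∤1
    ∤-^ (suc n) ∤a = ∤-* ∤a (∤-^ n ∤a)

    ∤-≅ : ∀ {a b} → a ≅ b [ P ] → ¬ P ∣ b → ¬ P ∣ a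
    ∤-≅ e ∤b d = ∤b (∣-≅ (≅-sym e) d)

    ∤-below : ∀ k → suc k ℕ.< p → ¬ P ∣ + suc k
    ∤-below k k<p d = ℕ.<⇒≱ k<p (ℕ.∣⇒≤ (∣⇒∣ᵤ d))

    open UnitsBelow p p (λ k x k<p → P∣*⇒P∣ {+ suc k} {x} (∤-below k k<p)) public

    -- In the recurrence for power sums with left side N^p, `p` divides every C(p, j) with 0 < j <
    -- p, and the term j = 0 is N.
    fermat-* : ∀ r → p ≡ suc r → ∀ N → (+ N) ^ p ≅ + N [ P ]
    fermat-* r refl N = begin
      (+ N) ^ suc r
        ≡⟨ Σ-choose-powerSum r N ⟨
      Σ< (suc r) (λ j → suc r choose j * powerSum j N)
        ≡⟨ Σ-head r (λ j → suc r choose j * powerSum j N) ⟩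
      1ℤ * powerSum 0 N + Σ< r (λ j → suc r choose suc j * powerSum (suc j) N)
        ≈⟨ ≅-+ (≅-reflexive (trans (*-identityˡ _) (trans (Σ-const N 1ℤ) (*-identityʳ (+ N)))))
               (∣⇒≅0 (Σ-∣ r λ j j<r → ∣m⇒∣m*n (powerSum (suc j) N)
                 (subst (λ z → P ∣ z choose suc j) (ℕ.+-identityʳ (suc r)) (∣choose 0 (suc j) (s≤s z≤n) (s≤s j<r))))) ⟩
      + N + 0ℤ ≡⟨ +-identityʳ (+ N) ⟩
      + N ∎
      where open import Relation.Binary.Reasoning.Setoid (≅-setoid P)

    fermat : ∀ r → p ≡ suc r → ∀ {N} → ¬ P ∣ + N → (+ N) ^ r ≅ 1ℤ [ P ]
    fermat r p≡ {N} ∤N = mod (P∣*⇒P∣ {+ N} ∤N (∣-by (lem (+ N) ((+ N) ^ r))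
      (∣diff (subst (λ q → (+ N) ^ q ≅ + N [ P ]) p≡ (fermat-* r p≡ N)))))
      where lem : ∀ n x → n * (x - 1ℤ) ≡ n * x - n
            lem = solve-∀

-- Odd primes: Wilson, Glaisher, and the passage from q to E

module OddPrimes (p : ℕ) (p-prime : Prime p) (s : ℕ) (p≡ : p ≡ suc (suc (suc (Modular.double s)))) where
  open Modular
  open Eulerian
  open PowerSums
  open import Data.Integer using (ℤ; +_; 0ℤ; 1ℤ; -1ℤ; _+_; _*_; _-_; -_; _^_)
  open import Data.Integer.Properties
  open import Data.Integer.Divisibility.Signed
  open import Data.Integer.Tactic.RingSolver using (solve-∀)
  open import Data.Nat.Combinatorics using (nCn≡1)
  open PrimeModulus p p-prime public

  -- Here p = r + 3, so `suc r` is the exponent p - 2 and `suc (suc r)` the exponent p - 1.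
  r : ℕ
  r = double s

  3+r≤p : 3 ℕ.+ r ℕ.≤ p
  3+r≤p = ℕ.≤-reflexive (sym p≡)

  P≡ : P ≡ + 1 + + suc (suc r)
  P≡ = cong +_ p≡

  P-1≡ : + suc (suc r) ≡ P - 1ℤ
  P-1≡ = trans (lem (+ suc (suc r))) (cong (_- 1ℤ) (sym P≡))
    where lem : ∀ x → x ≡ + 1 + x - 1ℤ
          lem = solve-∀

  sgn-suc-double : ∀ m → sgn (suc (double m)) ≡ -1ℤ
  sgn-suc-double m = cong -_ (sgn-double m)

  -1^double : ∀ m → -1ℤ ^ double m ≡ 1ℤ
  -1^double zero    = refl
  -1^double (suc m) = trans (lem (-1ℤ ^ double m)) (-1^double m)
    where lem : ∀ x → -1ℤ * (-1ℤ * x) ≡ x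
          lem = solve-∀

  ∤2 : ¬ P ∣ + 2
  ∤2 = ∤-below 1 (ℕ.≤-trans (s≤s (s≤s (s≤s z≤n))) 3+r≤p)

  S : ℤ
  S = powerSum (suc (suc r)) p

  S-suc : S ≡ Σ< (suc (suc r)) (λ k → (+ suc k) ^ suc (suc r))
  S-suc = trans (cong (powerSum (suc (suc r))) p≡)
    (trans (Σ-head (suc (suc r)) (λ k → (+ k) ^ suc (suc r))) (trans
      (cong (_+ Σ< (suc (suc r)) (λ k → (+ suc k) ^ suc (suc r))) (*-zeroˡ (0ℤ ^ suc r)))
      (+-identityˡ _)))

  fermat-below : ∀ k → suc k ℕ.< p → (+ suc k) ^ suc (suc r) ≅ 1ℤ [ P ]
  fermat-below k k<p = fermat (suc (suc r)) p≡ (∤-below k k<p)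

  S≅-1 : S ≅ -1ℤ [ P ]
  S≅-1 = begin
    S                            ≡⟨ S-suc ⟩
    Σ< (suc (suc r)) (λ k → (+ suc k) ^ suc (suc r))
      ≈⟨ Σ-≅ (suc (suc r)) (λ k k<n → fermat-below k (ℕ.≤-trans (s≤s k<n) 3+r≤p)) ⟩
    Σ< (suc (suc r)) (λ _ → 1ℤ)  ≡⟨ trans (Σ-const (suc (suc r)) 1ℤ) (*-identityʳ _) ⟩
    + suc (suc r)                ≡⟨ P-1≡ ⟩
    P - 1ℤ                       ≈⟨ ≅-- (∣⇒≅0 ∣-refl) (≅-refl {1ℤ}) ⟩
    -1ℤ                          ∎
    where open import Relation.Binary.Reasoning.Setoid (≅-setoid P)

  W : ℤ
  W = factorial (suc (suc r))

  -- Each Pascal step adds a coefficient with lower index p - 1, divisible by `p` as long as a < p -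
  -- 1.
  choose-p : ∀ a → a ℕ.< p → (p ℕ.+ a) choose p ≅ 1ℤ [ P ]
  choose-p zero a<p = ≅-reflexive (trans (cong (_choose p) (ℕ.+-identityʳ p)) (cong +_ (nCn≡1 p)))
  choose-p (suc a) a<p = begin
    (p ℕ.+ suc a) choose p                   ≡⟨ cong₂ _choose_ (ℕ.+-suc p a) p≡ ⟩
    suc (p ℕ.+ a) choose suc p-1             ≡⟨ pascal (p ℕ.+ a) p-1 ⟩
    (p ℕ.+ a) choose p-1 + (p ℕ.+ a) choose suc p-1
      ≈⟨ ≅-+ (∣⇒≅0 (∣choose a p-1 (ℕ.≤-pred (subst (suc a ℕ.<_) p≡ a<p)) 3+r≤p))
             (subst (λ z → (p ℕ.+ a) choose z ≅ 1ℤ [ P ]) p≡ (choose-p a (ℕ.<-trans (ℕ.n<1+n a) a<p))) ⟩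
    1ℤ ∎
    where
    p-1 = suc (suc r)
    open import Relation.Binary.Reasoning.Setoid (≅-setoid P)

  -- At the exponent p - 1 the coefficients C(p + a, p) are congruent to 1 instead of 0, so every
  -- permutation of p - 1 letters counts once. Since Fermat gives S ≡ -1, this proves Wilson's
  -- theorem.
  S≅W : S ≅ W [ P ]
  S≅W = begin
    S
      ≈⟨ powerSum-choose P p (suc r) ⟩
    Eul (suc r) (λ a → (p ℕ.+ a) choose suc (suc (suc r)))
      ≈⟨ Eul-≅ (suc r) (λ a a≤ → subst (λ z → (p ℕ.+ a) choose z ≅ 1ℤ [ P ]) p≡
           (choose-p a (ℕ.≤-trans (ℕ.m≤n⇒m≤1+n (s≤s a≤)) 3+r≤p))) ⟩
    Eul (suc r) (λ _ → 1ℤ)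
      ≡⟨ trans (Eul-1 (suc r) 1ℤ) (*-identityˡ W) ⟩
    W ∎
    where open import Relation.Binary.Reasoning.Setoid (≅-setoid P)

  wilson : W ≅ -1ℤ [ P ]
  wilson = ≅-trans (≅-sym S≅W) S≅-1

  -- By Fermat each k^(p-1) is 1 plus a multiple of `p`, and modulo p² a product of such factors
  -- depends only on the sum of the deviations.
  factorial-power : ∀ n → n ℕ.< p →
    factorial n ^ suc (suc r) ≅ 1ℤ + Σ< n (λ k → (+ suc k) ^ suc (suc r) - 1ℤ) [ P * P ]
  factorial-power zero    _   = ≅-reflexive (^-zeroˡ (suc (suc r)))
  factorial-power (suc n) n<p = begin
    (+ suc n * factorial n) ^ suc (suc r)
      ≡⟨ ^-distribʳ-* (+ suc n) (factorial n) (suc (suc r)) ⟩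
    x * factorial n ^ suc (suc r)
      ≈⟨ ≅-*ˡ x (factorial-power n (ℕ.<-trans (ℕ.n<1+n n) n<p)) ⟩
    x * (1ℤ + t)
      ≡⟨ lem x t ⟩
    1ℤ + (t + (x - 1ℤ)) + (x - 1ℤ) * t
      ≈⟨ ≅-+ (≅-refl {1ℤ + (t + (x - 1ℤ))}) (∣⇒≅0 (∣∣⇒*∣* (∣diff (fermat-below n n<p))
           (Σ-∣ n λ k k<n → ∣diff (fermat-below k (ℕ.≤-trans (s≤s k<n) (ℕ.<⇒≤ n<p)))))) ⟩
    1ℤ + (t + (x - 1ℤ)) + 0ℤ
      ≡⟨ +-identityʳ (1ℤ + (t + (x - 1ℤ))) ⟩
    1ℤ + (t + (x - 1ℤ)) ∎
    where
    open import Relation.Binary.Reasoning.Setoid (≅-setoid (P * P))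
    x = (+ suc n) ^ suc (suc r)
    t = Σ< n (λ k → (+ suc k) ^ suc (suc r) - 1ℤ)
    lem : ∀ x t → x * (1ℤ + t) ≡ 1ℤ + (t + (x - 1ℤ)) + (x - 1ℤ) * t
    lem = solve-∀

  -- W^(p-1) is computed twice. Wilson gives W = -1 + d with p dividing `d`, so the power is 1 -
  -- (p-1) d ≡ 1 + d; factor by factor it is 1 + S - (p - 1).
  glaisher : W ≅ S - P [ P * P ]
  glaisher = mod (∣-by (lem W S P) (∣diff (≅-trans (≅-sym left) right)))
    where
    open import Relation.Binary.Reasoning.Setoid (≅-setoid (P * P))
    lem : ∀ w s p → w - (s - p) ≡ (1ℤ + (w - -1ℤ)) - (1ℤ + (s - (p - 1ℤ)))
    lem = solve-∀
    lem₁ : ∀ w → w ≡ -1ℤ + (w - -1ℤ)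
    lem₁ = solve-∀
    lem₂ : ∀ d → 1ℤ + (P - 1ℤ) * (-1ℤ * d) ≡ 1ℤ + d + (- (P * d))
    lem₂ d = lem₃ P d
      where lem₃ : ∀ p d → 1ℤ + (p - 1ℤ) * (-1ℤ * d) ≡ 1ℤ + d + (- (p * d))
            lem₃ = solve-∀
    d = W - -1ℤ
    P∣d : P ∣ d
    P∣d = ∣diff wilson
    left : W ^ suc (suc r) ≅ 1ℤ + d [ P * P ]
    left = begin
      W ^ suc (suc r)
        ≡⟨ cong (_^ suc (suc r)) (lem₁ W) ⟩
      (-1ℤ + d) ^ suc (suc r)
        ≈⟨ ≅-weaken (∣∣⇒*∣* P∣d P∣d) (^-expand₁ -1ℤ d (suc r)) ⟩
      -1ℤ * (-1ℤ * -1ℤ ^ r) + + suc (suc r) * (-1ℤ * -1ℤ ^ r * d)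
        ≡⟨ cong₂ (λ a b → -1ℤ * (-1ℤ * a) + b * (-1ℤ * a * d)) (-1^double s) P-1≡ ⟩
      1ℤ + (P - 1ℤ) * (-1ℤ * d)
        ≡⟨ lem₂ d ⟩
      1ℤ + d + (- (P * d))
        ≈⟨ ≅-+ (≅-refl {1ℤ + d}) (∣⇒≅0 (∣m⇒∣-m (∣∣⇒*∣* (∣-refl {P}) P∣d))) ⟩
      1ℤ + d + 0ℤ
        ≡⟨ +-identityʳ (1ℤ + d) ⟩
      1ℤ + d ∎
    right : W ^ suc (suc r) ≅ 1ℤ + (S - (P - 1ℤ)) [ P * P ]
    right = begin
      W ^ suc (suc r)
        ≈⟨ factorial-power (suc (suc r)) 3+r≤p ⟩
      1ℤ + Σ< (suc (suc r)) (λ k → (+ suc k) ^ suc (suc r) - 1ℤ)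
        ≡⟨ cong (λ z → 1ℤ + z) (Σ-+ (suc (suc r)) (λ k → (+ suc k) ^ suc (suc r)) (λ _ → -1ℤ)) ⟩
      1ℤ + (Σ< (suc (suc r)) (λ k → (+ suc k) ^ suc (suc r)) + Σ< (suc (suc r)) (λ _ → -1ℤ))
        ≡⟨ cong₂ (λ a b → 1ℤ + (a + b)) (sym S-suc) (trans (Σ-const (suc (suc r)) -1ℤ) (trans (*-comm (+ suc (suc r)) -1ℤ) (-1*i≡-i (+ suc (suc r))))) ⟩
      1ℤ + (S - + suc (suc r))
        ≡⟨ cong (λ z → 1ℤ + (S - z)) P-1≡ ⟩
      1ℤ + (S - (P - 1ℤ)) ∎

  instance
    p²-nonZero : ℕ.NonZero (p ℕ.* p)
    p²-nonZero = ℕ.m*n≢0 p p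

  P²≡ : + (p ℕ.* p) ≡ P * P
  P²≡ = pos-* p p

  module P² = UnitsBelow p (p ℕ.* p) (λ k x k<p d → subst (_∣ x) (sym P²≡)
    (P²∣*⇒P²∣ {+ suc k} {x} (∤-below k k<p) (subst (_∣ + suc k * x) P²≡ d)))

  odd-* : ∀ a b → suc (double a) ℕ.* suc (double b) ≡ suc (double (b ℕ.+ a ℕ.* suc (double b)))
  odd-* a b = cong suc (trans (cong (double b ℕ.+_) (double-* a (suc (double b)))) (double-+ b (a ℕ.* suc (double b))))
    where
    double-* : ∀ a c → double a ℕ.* c ≡ double (a ℕ.* c)
    double-* zero    c = refl
    double-* (suc a) c = trans (sym (ℕ.+-assoc c c (double a ℕ.* c)))
      (trans (cong (c ℕ.+ c ℕ.+_) (double-* a c)) (trans (cong (ℕ._+ double (a ℕ.* c)) (n+n≡double c)) (double-+ c (a ℕ.* c))))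

  -- (p² - 1) / 2, in the form that `odd-*` delivers.
  m₂ : ℕ
  m₂ = suc s ℕ.+ suc s ℕ.* suc (double (suc s))

  p²≡ : p ℕ.* p ≡ suc (double m₂)
  p²≡ = trans (cong₂ ℕ._*_ p≡ p≡) (odd-* (suc s) (suc s))

  O : ℤ
  O = Σ< m₂ (λ i → (+ suc (double i)) ^ suc r)

  E : ℤ
  E = Eul r sgn

  -- The full power sum left by `Alt-odd` has exponent p - 2 and vanishes modulo p²; what remains is
  -- `O` times (-2)^(p-1), a unit.
  P²∣E⇔P²∣O : P * P ∣ E ⇔ P * P ∣ O
  P²∣E⇔P²∣O = mk⇔
    (λ d → P²∣*⇒P²∣ ∤c (∣-≅ (≅-sym E≅) d))
    (λ d → ∣-≅ E≅ (∣n⇒∣m*n ((- + 2) ^ suc r * (- + 2)) d))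
    where
    open import Relation.Binary.Reasoning.Setoid (≅-setoid (P * P))
    ∤-2 : ¬ P ∣ - + 2
    ∤-2 d = ∤2 (∣m⇒∣-m d)
    ∤c : ¬ P ∣ (- + 2) ^ suc r * (- + 2)
    ∤c = ∤-* (∤-^ (suc r) ∤-2) ∤-2
    M = p ℕ.* p
    open P².OddModulus (trans (cong sgn p²≡) (sgn-suc-double m₂))
    lem : ∀ c o → c * (0ℤ - + 2 * o) ≡ c * (- + 2) * o
    lem = solve-∀
    c = (- + 2) ^ suc r
    f : ℕ → ℤ
    f k = (+ k) ^ suc r
    E≅ : E ≅ c * (- + 2) * O [ P * P ]
    E≅ = begin
      E
        ≈⟨ subst (E ≅ c * Alt M f [_]) P²≡ (≅-sym (Alt-power r (ℕ.≤-trans (ℕ.n≤1+n _) 3+r≤p))) ⟩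
      c * Alt M f
        ≡⟨ cong (λ z → c * Alt z f) p²≡ ⟩
      c * Alt (suc (double m₂)) f
        ≡⟨ cong (c *_) (Alt-odd m₂ f) ⟩
      c * (Σ< (suc (double m₂)) f - + 2 * O)
        ≈⟨ ≅-*ˡ c (≅-- (∣⇒≅0 (subst₂ (λ a b → a ∣ powerSum (suc r) b) P²≡ p²≡ (P².∣powerSum r 3+r≤p)))
             (≅-refl {+ 2 * O})) ⟩
      c * (0ℤ - + 2 * O)
        ≡⟨ lem c O ⟩
      c * (- + 2) * O ∎

  -- In a block starting at a multiple `y` of `p`, the linear correction is (p-1) y times the sum of
  -- k^(p-2) over k < p, and both `y` and that sum are divisible by `p`.
  powerSum-blocks : ∀ j → powerSum (suc (suc r)) (j ℕ.* p) ≅ + j * S [ P * P ]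
  powerSum-blocks zero    = ≅-reflexive (sym (*-zeroˡ S))
  powerSum-blocks (suc j) = begin
    powerSum (suc (suc r)) (p ℕ.+ j ℕ.* p)
      ≡⟨ cong (powerSum (suc (suc r))) (ℕ.+-comm p (j ℕ.* p)) ⟩
    powerSum (suc (suc r)) (j ℕ.* p ℕ.+ p)
      ≡⟨ Σ-split (j ℕ.* p) p (λ k → (+ k) ^ suc (suc r)) ⟩
    powerSum (suc (suc r)) (j ℕ.* p) + Σ< p (λ k → (+ (j ℕ.* p ℕ.+ k)) ^ suc (suc r))
      ≈⟨ ≅-+ (powerSum-blocks j) block ⟩
    + j * S + S
      ≡⟨ lem (+ j) S ⟩
    + suc j * S ∎
    where
    open import Relation.Binary.Reasoning.Setoid (≅-setoid (P * P))
    lem : ∀ j s → j * s + s ≡ (1ℤ + j) * s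
    lem = solve-∀
    y = + (j ℕ.* p)
    P∣y : P ∣ y
    P∣y = divides (+ j) (pos-* j p)
    lem′ : ∀ a x y → a * (x * y) ≡ a * y * x
    lem′ = solve-∀
    block : Σ< p (λ k → (+ (j ℕ.* p ℕ.+ k)) ^ suc (suc r)) ≅ S [ P * P ]
    block = begin
      Σ< p (λ k → (y + + k) ^ suc (suc r))
        ≈⟨ Σ-≅ p (λ k _ → ≅-trans (≅-reflexive (cong (_^ suc (suc r)) (+-comm y (+ k))))
             (≅-weaken (∣∣⇒*∣* P∣y P∣y) (^-expand₁ (+ k) y (suc r)))) ⟩
      Σ< p (λ k → (+ k) ^ suc (suc r) + + suc (suc r) * ((+ k) ^ suc r * y))
        ≡⟨ Σ-+ p (λ k → (+ k) ^ suc (suc r)) (λ k → + suc (suc r) * ((+ k) ^ suc r * y)) ⟩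
      S + Σ< p (λ k → + suc (suc r) * ((+ k) ^ suc r * y))
        ≡⟨ cong (λ z → S + z) (trans (Σ-cong p λ k → lem′ (+ suc (suc r)) ((+ k) ^ suc r) y)
             (Σ-* p (+ suc (suc r) * y) (λ k → (+ k) ^ suc r))) ⟩
      S + + suc (suc r) * y * powerSum (suc r) p
        ≈⟨ ≅-+ (≅-refl {S}) (∣⇒≅0 (∣∣⇒*∣* (∣n⇒∣m*n (+ suc (suc r)) P∣y) (∣powerSum r 3+r≤p))) ⟩
      S + 0ℤ
        ≡⟨ +-identityʳ S ⟩
      S ∎

  -- Doubling over p² terms holds modulo p⁴. With T = p u and 2^(p-1) = 1 + p q it reads p² u q ≡
  -- (p-1) p² O; dividing by p² leaves u q ≡ (p-1) O modulo p², where `u` and p - 1 are units.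
  P²∣q⇔P²∣O : ∀ q → (+ 2) ^ suc (suc r) ≡ 1ℤ + P * q → P * P ∣ q ⇔ P * P ∣ O
  P²∣q⇔P²∣O q 2^≡ = mk⇔
    (λ d → P²∣*⇒P²∣ ∤p-1 (∣-≅ (≅-sym qu≅) (∣n⇒∣m*n u d)))
    (λ d → P²∣*⇒P²∣ ∤u (∣-≅ qu≅ (∣n⇒∣m*n (+ suc (suc r)) d)))
    where
    M = p ℕ.* p
    T = powerSum (suc (suc r)) M
    T≅ : T ≅ P * S [ P * P ]
    T≅ = powerSum-blocks p
    -- T ≡ p S is known only modulo p², but dividing modulo p⁴ requires an exact factor `p` of `T`;
    -- so the error t p² is absorbed into `u`.
    t = quotient (∣diff T≅)
    u = S + t * P
    T≡ : T ≡ P * u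
    T≡ = trans (lem T (P * S)) (trans (cong (_+ P * S) (_∣_.equality (∣diff T≅))) (lem′ t P S))
      where lem : ∀ a b → a ≡ (a - b) + b
            lem = solve-∀
            lem′ : ∀ t p s → t * (p * p) + p * s ≡ p * (s + t * p)
            lem′ = solve-∀
    u≅-1 : u ≅ -1ℤ [ P ]
    u≅-1 = ≅-trans (≅-+ S≅-1 (∣⇒≅0 (∣n⇒∣m*n t ∣-refl))) (≅-refl { -1ℤ })
    ∤u : ¬ P ∣ u
    ∤u = ∤-≅ u≅-1 ∤-1
    ∤p-1 : ¬ P ∣ + suc (suc r)
    ∤p-1 = ∤-below (suc r) 3+r≤p
    doubled : (+ 2) ^ suc (suc r) * T ≅ T + + suc (suc r) * (P * P) * O [ (P * P) * (P * P) ]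
    doubled = subst (λ m → (+ 2) ^ suc (suc r) * T ≅ T + + suc (suc r) * m * O [ m * m ]) P²≡
      (subst (λ m → (+ 2) ^ suc (suc r) * powerSum (suc (suc r)) m ≅ powerSum (suc (suc r)) m + + suc (suc r) * + m * O [ + m * + m ])
        (sym p²≡) (doubled-powerSum m₂ (suc r)))
    qu≅ : u * q ≅ + suc (suc r) * O [ P * P ]
    qu≅ = mod (*-cancelˡ-∣ (P * P) {{i*j≢0 P P}} (∣-by
      (trans (lem P u q (+ suc (suc r)) O) (sym (cong₂ (λ a b → a * b - (b + + suc (suc r) * (P * P) * O)) 2^≡ T≡)))
      (∣diff doubled)))
      where lem : ∀ p u q c o → p * p * (u * q - c * o) ≡ (1ℤ + p * q) * (p * u) - (p * u + c * (p * p) * o)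
            lem = solve-∀

-- The odd harmonic sum through elementary symmetric functions

module Harmonic where
  open Modular
  open Eulerian
  open PowerSums
  open import Data.Integer using (ℤ; +_; 0ℤ; 1ℤ; _+_; _*_; _-_; -_; _^_; NonZero)
  open import Data.Integer.Properties
  open import Data.Integer.Divisibility.Signed
  open import Data.Integer.Tactic.RingSolver using (solve-∀)

  odd : ℕ → ℤ
  odd i = + suc (double i)

  -- The elementary symmetric functions of 1/k over the first m odd numbers k, scaled by
  -- the product e₀ m of these numbers.
  e₀ e₁ e₂ : ℕ → ℤ
  e₀ zero    = 1ℤ
  e₀ (suc m) = odd m * e₀ m
  e₁ zero    = 0ℤ
  e₁ (suc m) = odd m * e₁ m + e₀ m
  e₂ zero    = 0ℤ
  e₂ (suc m) = odd m * e₂ m + e₁ m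

  -- the sum of 1/k², scaled by (e₀ m)²
  s₂ : ℕ → ℤ
  s₂ zero    = 0ℤ
  s₂ (suc m) = odd m * odd m * s₂ m + e₀ m * e₀ m

  newton : ∀ m → + 2 * (e₀ m * e₂ m) ≡ e₁ m * e₁ m - s₂ m
  newton zero    = refl
  newton (suc m) = trans (lem (odd m) (e₀ m) (e₁ m) (e₂ m)) (trans
    (cong (λ z → odd m * odd m * z + + 2 * (odd m * e₀ m * e₁ m)) (newton m))
    (lem′ (odd m) (e₀ m) (e₁ m) (s₂ m)))
    where
    lem : ∀ k a b c → + 2 * (k * a * (k * c + b)) ≡ k * k * (+ 2 * (a * c)) + + 2 * (k * a * b)
    lem = solve-∀
    lem′ : ∀ k a b g → k * k * (b * b - g) + + 2 * (k * a * b) ≡ (k * b + a) * (k * b + a) - (k * k * g + a * a)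
    lem′ = solve-∀

  shifted : ℕ → ℤ → ℤ
  shifted zero    x = 1ℤ
  shifted (suc m) x = (odd m + x) * shifted m x

  shifted-≅ : ∀ m x → shifted m x ≅ e₀ m + x * e₁ m + x * x * e₂ m [ x * (x * x) ]
  shifted-≅ zero    x = ≅-reflexive (lem x)
    where lem : ∀ x → 1ℤ ≡ 1ℤ + x * 0ℤ + x * x * 0ℤ
          lem = solve-∀
  shifted-≅ (suc m) x = ≅-trans (≅-*ˡ (odd m + x) (shifted-≅ m x))
    (mod (divides (e₂ m) (lem (odd m) x (e₀ m) (e₁ m) (e₂ m))))
    where lem : ∀ k x a b c → (k + x) * (a + x * b + x * x * c)
                  - (k * a + x * (k * b + a) + x * x * (k * c + b)) ≡ c * (x * (x * x))
          lem = solve-∀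

  -- `e₀ m` is the double factorial (2m - 1)!!.
  factorial-double : ∀ m → factorial (double m) ≡ (+ 2) ^ m * factorial m * e₀ m
  factorial-double zero    = refl
  factorial-double (suc m) = trans
    (cong₂ (λ a b → a * (odd m * b)) (+double (suc m)) (factorial-double m))
    (lem (+ suc m) (odd m) ((+ 2) ^ m) (factorial m) (e₀ m))
    where lem : ∀ n k t f e → + 2 * n * (k * (t * f * e)) ≡ + 2 * t * (n * f) * (k * e)
          lem = solve-∀

  -- The i-th odd number plus 2 m + 1 is 2 (m + i + 1).
  factorial-shifted : ∀ m n → factorial m * shifted n (odd m) ≡ (+ 2) ^ n * factorial (n ℕ.+ m)
  factorial-shifted m zero    = *-comm (factorial m) 1ℤ
  factorial-shifted m (suc n) = trans
    (trans (lem (factorial m) (odd n + odd m) (shifted n (odd m)))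
      (cong₂ _*_ step (factorial-shifted m n)))
    (lem″ (+ suc (n ℕ.+ m)) ((+ 2) ^ n) (factorial (n ℕ.+ m)))
    where
    lem : ∀ f a s → f * (a * s) ≡ a * (f * s)
    lem = solve-∀
    lem′ : ∀ n m → (1ℤ + + 2 * n) + (1ℤ + + 2 * m) ≡ + 2 * (1ℤ + (n + m))
    lem′ = solve-∀
    lem″ : ∀ a t f → + 2 * a * (t * f) ≡ + 2 * t * (a * f)
    lem″ = solve-∀
    step : odd n + odd m ≡ + 2 * + suc (n ℕ.+ m)
    step = trans (cong₂ (λ a b → (1ℤ + a) + (1ℤ + b)) (+double n) (+double m)) (lem′ (+ n) (+ m))

  factorial-nonZero : ∀ n → NonZero (factorial n)
  factorial-nonZero zero    = _
  factorial-nonZero (suc n) = i*j≢0 (+ suc n) (factorial n) {{_}} {{factorial-nonZero n}}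

  -- Adding 2m + 1 to the odd numbers below it gives the even numbers from 2m + 2 to 4m. Multiplied
  -- by m!, both sides are 2^m (2m)!.
  shifted-odd : ∀ m → shifted m (odd m) ≡ (+ 2) ^ double m * e₀ m
  shifted-odd m = *-cancelˡ-≡ (factorial m) _ _ {{factorial-nonZero m}} (begin
    factorial m * shifted m (odd m)
      ≡⟨ factorial-shifted m m ⟩
    (+ 2) ^ m * factorial (m ℕ.+ m)
      ≡⟨ cong (λ n → (+ 2) ^ m * factorial n) (n+n≡double m) ⟩
    (+ 2) ^ m * factorial (double m)
      ≡⟨ cong ((+ 2) ^ m *_) (factorial-double m) ⟩
    (+ 2) ^ m * ((+ 2) ^ m * factorial m * e₀ m)
      ≡⟨ lem ((+ 2) ^ m) (factorial m) (e₀ m) ⟩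
    factorial m * ((+ 2) ^ m * (+ 2) ^ m * e₀ m)
      ≡⟨ cong (λ z → factorial m * (z * e₀ m)) (trans (sym (^-distribˡ-+-* (+ 2) m m)) (cong ((+ 2) ^_) (n+n≡double m))) ⟩
    factorial m * ((+ 2) ^ double m * e₀ m) ∎)
    where
    open ≡-Reasoning
    lem : ∀ t f e → t * (t * f * e) ≡ f * (t * t * e)
    lem = solve-∀

  neg-^-double : ∀ x s → (- x) ^ double s ≡ x ^ double s
  neg-^-double x zero    = refl
  neg-^-double x (suc s) = trans (lem x ((- x) ^ double s)) (cong (λ z → x * (x * z)) (neg-^-double x s))
    where lem : ∀ x y → (- x) * ((- x) * y) ≡ x * (x * y)
          lem = solve-∀

  module OddHarmonic (p : ℕ) (p-prime : Prime p) (s : ℕ)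
    (p≡ : p ≡ suc (double (suc (suc s)))) where

    open PrimeModulus p p-prime

    h : ℕ
    h = suc (suc s)

    -- The exponent p - 3: modulo `p`, k^(p-3) stands for 1/k².
    r : ℕ
    r = double (suc s)

    odd≤ : ∀ i → i ℕ.< h → suc (double i) ℕ.< p
    odd≤ i i<h = subst (suc (double i) ℕ.<_) (sym p≡) (s≤s (double-< i<h))
      where
      double-< : ∀ {i h} → i ℕ.< h → double i ℕ.< double h
      double-< {zero}  (s≤s _)   = s≤s z≤n
      double-< {suc i} (s≤s i<h) = s≤s (s≤s (double-< i<h))

    -- Since `r` is even, k ↦ p - k matches the odd terms with the even ones, so twice this sum is
    -- the full power sum. The latter vanishes modulo `p` because 0 < r < p - 1, which is where p >
    -- 3 enters.
    Σ-odd-powers : P ∣ Σ< h (λ i → odd i ^ r)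
    Σ-odd-powers = P∣*⇒P∣ ∤2 (∣-by (lem o) (∣-≅ (≅-+ evens (≅-refl {o})) all))
      where
      open import Relation.Binary.Reasoning.Setoid (≅-setoid P)
      ∤2 : ¬ P ∣ + 2
      ∤2 = ∤-below 1 (subst (2 ℕ.<_) (sym p≡) (s≤s (s≤s (s≤s z≤n))))
      o = Σ< h (λ i → odd i ^ r)
      lem : ∀ o → + 2 * o ≡ o + o
      lem = solve-∀
      all : P ∣ Σ< h (λ i → (+ double (suc i)) ^ r) + o
      all = ∣-by (sym (trans (Σ-even-odd h (λ k → (+ k) ^ r)) (cong (_+ o)
          (trans (Σ-head h (λ i → (+ double i) ^ r)) (trans
            (cong (_+ Σ< h (λ i → (+ double (suc i)) ^ r)) (*-zeroˡ (0ℤ ^ suc (double s))))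
            (+-identityˡ (Σ< h (λ i → (+ double (suc i)) ^ r))))))))
        (subst (λ z → P ∣ powerSum r z) p≡ (∣powerSum (suc (double s)) (subst (suc r ℕ.<_) (sym p≡) (s≤s (s≤s (ℕ.n≤1+n _))))))
      evens : o ≅ Σ< h (λ i → (+ double (suc i)) ^ r) [ P ]
      evens = begin
        o
          ≡⟨ Σ-reverse h (λ i → odd i ^ r) ⟩
        Σ< h (λ i → odd (h ℕ.∸ suc i) ^ r)
          ≈⟨ Σ-≅ h (λ i i<h → ≅-^ r (reflect i i<h)) ⟩
        Σ< h (λ i → (- + double (suc i)) ^ r)
          ≡⟨ Σ-cong h (λ i → neg-^-double (+ double (suc i)) (suc s)) ⟩
        Σ< h (λ i → (+ double (suc i)) ^ r) ∎
        where
        reflect : ∀ i → i ℕ.< h → odd (h ℕ.∸ suc i) ≅ - + double (suc i) [ P ]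
        reflect i i<h = mod (∣-reflexive (trans (cong +_ (trans p≡ (cong suc (sym
          (trans (double-+ (h ℕ.∸ suc i) (suc i)) (cong double (ℕ.m∸n+n≡m i<h)))))))
          (lem′ (+ double (h ℕ.∸ suc i)) (+ double (suc i)))))
          where lem′ : ∀ a b → 1ℤ + (a + b) ≡ (1ℤ + a) - (- b)
                lem′ = solve-∀

    s₂-≅ : ∀ m → m ℕ.≤ h → s₂ m ≅ e₀ m * e₀ m * Σ< m (λ i → odd i ^ r) [ P ]
    s₂-≅ zero    _   = ≅-refl
    s₂-≅ (suc m) m<h = begin
      k * k * s₂ m + e₀ m * e₀ m
        ≡⟨ cong (λ z → k * k * s₂ m + z) (*-identityʳ (e₀ m * e₀ m)) ⟨
      k * k * s₂ m + e₀ m * e₀ m * 1ℤ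
        ≈⟨ ≅-+ (≅-*ˡ (k * k) (s₂-≅ m (ℕ.<⇒≤ m<h)))
               -- The factor 1 becomes k^(p-1) = k · k · k^r, so that k² can be pulled out.
               (≅-*ˡ (e₀ m * e₀ m) (≅-sym (fermat (suc (suc r)) p≡ (∤-below (double m) (odd≤ m m<h))))) ⟩
      k * k * (e₀ m * e₀ m * σ) + e₀ m * e₀ m * (k * (k * k ^ r))
        ≡⟨ lem k (e₀ m) σ (k ^ r) ⟩
      k * e₀ m * (k * e₀ m) * (σ + k ^ r) ∎
      where
      open import Relation.Binary.Reasoning.Setoid (≅-setoid P)
      k = odd m
      σ = Σ< m (λ i → odd i ^ r)
      lem : ∀ k e s x → k * k * (e * e * s) + e * e * (k * (k * x)) ≡ k * e * (k * e) * (s + x)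
      lem = solve-∀

    ∤e₀ : ∀ m → m ℕ.≤ h → ¬ P ∣ e₀ m
    ∤e₀ zero    _   = ∤1
    ∤e₀ (suc m) m<h = ∤-* (∤-below (double m) (odd≤ m m<h)) (∤e₀ m (ℕ.<⇒≤ m<h))

    ∣e₁⇒∣e₂ : P ∣ e₁ h → P ∣ e₂ h
    ∣e₁⇒∣e₂ d = P∣*⇒P∣ (∤e₀ h ℕ.≤-refl) (P∣*⇒P∣ {+ 2} ∤2 (∣-by (newton h)
      (∣m∣n⇒∣m-n (∣m⇒∣m*n (e₁ h) d) (∣-≅ (s₂-≅ h ℕ.≤-refl) (∣n⇒∣m*n (e₀ h * e₀ h) Σ-odd-powers)))))
      where
      ∤2 : ¬ P ∣ + 2
      ∤2 = ∤-below 1 (subst (2 ℕ.<_) (sym p≡) (s≤s (s≤s (s≤s z≤n))))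

    -- The term `P * e₂ h` need not vanish modulo p² by itself, but either side of the equivalence
    -- first yields p ∣ `e₁ h`, hence p ∣ `e₂ h`, and then the term drops out.
    P²∣q⇔P²∣e₁ : ∀ q → (+ 2) ^ double h ≡ 1ℤ + P * q → P * P ∣ q ⇔ P * P ∣ e₁ h
    P²∣q⇔P²∣e₁ q 2^≡ = mk⇔
      (λ d → ∣m+n∣n⇒∣m (∣-≅ (≅-sym q≅) (∣n⇒∣m*n (e₀ h) d))
        (∣∣⇒*∣* (∣-refl {P}) (∣e₁⇒∣e₂ (∣m+n∣n⇒∣m (∣-≅ (≅-weaken P∣P² (≅-sym q≅)) (∣n⇒∣m*n (e₀ h) (∣-trans P∣P² d)))
          (∣m⇒∣m*n (e₂ h) ∣-refl)))))
      (λ d → P²∣*⇒P²∣ (∤e₀ h ℕ.≤-refl) (∣-≅ q≅ (∣m∣n⇒∣m+n d (∣∣⇒*∣* (∣-refl {P}) (∣e₁⇒∣e₂ (∣-trans P∣P² d))))))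
      where
      P∣P² : P ∣ P * P
      P∣P² = ∣m⇒∣m*n P ∣-refl
      lem : ∀ p q a b c → p * (a * q - (b + p * c)) ≡ (1ℤ + p * q) * a - (a + p * b + p * p * c)
      lem = solve-∀
      q≅ : e₀ h * q ≅ e₁ h + P * e₂ h [ P * P ]
      -- The expansion of the product holds modulo p³, and 2^(p-1) - 1 = p q allows one division by
      -- `p`.
      q≅ = mod (*-cancelˡ-∣ P (∣-by
        (trans (lem P q (e₀ h) (e₁ h) (e₂ h)) (cong (λ z → z * e₀ h - (e₀ h + P * e₁ h + P * P * e₂ h)) (sym 2^≡)))
        (∣diff (≅-trans (≅-reflexive (trans (sym (shifted-odd h)) (cong (shifted h) (sym (cong +_ p≡))))) (shifted-≅ h P)))))

-- From lists of permutations to the functional `Eul`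

module Permutations where
  open Modular
  open Eulerian
  open import Data.Integer using (ℤ; +_; 0ℤ; 1ℤ; -1ℤ; _+_; _*_; _-_; -_)
  open import Data.Integer.Properties
  open import Data.Integer.Tactic.RingSolver using (solve-∀)
  open import Data.Bool using (true; false; if_then_else_)
  open import Data.List using (List; []; _∷_; map; concatMap; length; filter; _++_)
  open import Data.List.Properties using (filter-accept; filter-reject)
  open import Data.List.Relation.Unary.All as All using (All; []; _∷_)
  import Data.List.Relation.Unary.All.Properties as All
  open import Relation.Nullary.Decidable using (⌊_⌋; isYes≗does; dec-true; dec-false)
  open import Relation.Unary using (Decidable)

  Σᴸ : ∀ {A : Set} → List A → (A → ℤ) → ℤ
  Σᴸ []       f = 0ℤ
  Σᴸ (x ∷ xs) f = f x + Σᴸ xs f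

  module _ {A : Set} where

    Σᴸ-cong : ∀ (xs : List A) {f g : A → ℤ} → All (λ x → f x ≡ g x) xs → Σᴸ xs f ≡ Σᴸ xs g
    Σᴸ-cong []       []       = refl
    Σᴸ-cong (x ∷ xs) (e ∷ es) = cong₂ _+_ e (Σᴸ-cong xs es)

    Σᴸ-+ : ∀ (xs : List A) (f g : A → ℤ) → Σᴸ xs (λ x → f x + g x) ≡ Σᴸ xs f + Σᴸ xs g
    Σᴸ-+ []       f g = refl
    Σᴸ-+ (x ∷ xs) f g = trans (cong (λ z → f x + g x + z) (Σᴸ-+ xs f g))
      (lem (f x) (g x) (Σᴸ xs f) (Σᴸ xs g))
      where lem : ∀ a b c d → a + b + (c + d) ≡ a + c + (b + d)
            lem = solve-∀

    Σᴸ-++ : ∀ (xs ys : List A) (f : A → ℤ) → Σᴸ (xs ++ ys) f ≡ Σᴸ xs f + Σᴸ ys f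
    Σᴸ-++ []       ys f = sym (+-identityˡ (Σᴸ ys f))
    Σᴸ-++ (x ∷ xs) ys f = trans (cong (λ z → f x + z) (Σᴸ-++ xs ys f)) (sym (+-assoc (f x) _ _))

    Σᴸ-map : ∀ {B : Set} (g : B → A) xs (f : A → ℤ) → Σᴸ (map g xs) f ≡ Σᴸ xs (f ∘ g)
    Σᴸ-map g []       f = refl
    Σᴸ-map g (x ∷ xs) f = cong (λ z → f (g x) + z) (Σᴸ-map g xs f)

    Σᴸ-concatMap : ∀ {B : Set} (g : B → List A) xs (f : A → ℤ) →
      Σᴸ (concatMap g xs) f ≡ Σᴸ xs (λ x → Σᴸ (g x) f)
    Σᴸ-concatMap g []       f = refl
    Σᴸ-concatMap g (x ∷ xs) f = trans (Σᴸ-++ (g x) (concatMap g xs) f)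
      (cong (λ z → Σᴸ (g x) f + z) (Σᴸ-concatMap g xs f))

  step : ℕ → ℕ → ℕ
  step x y = if ⌊ x ℕ.<? y ⌋ then 1 else 0

  step-< : ∀ {x y} → x ℕ.< y → step x y ≡ 1
  step-< {x} {y} x<y = cong (if_then 1 else 0) (trans (isYes≗does (x ℕ.<? y)) (dec-true (x ℕ.<? y) x<y))

  step-≮ : ∀ {x y} → ¬ x ℕ.< y → step x y ≡ 0
  step-≮ {x} {y} x≮y = cong (if_then 1 else 0) (trans (isYes≗does (x ℕ.<? y)) (dec-false (x ℕ.<? y) x≮y))

  -- The new maximum goes to one of the `length (y ∷ ys)` places behind `y`: inside an ascent the
  -- number of ascents is unchanged, inside a descent or at the end it grows by one.
  Σ-insertions-tail : ∀ x y ys (g : ℕ → ℤ) → y ℕ.< x → All (ℕ._< x) ys →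
    Σᴸ (insertions x ys) (λ zs → g (ascents (y ∷ zs)))
      ≡ + ascents (y ∷ ys) * g (ascents (y ∷ ys))
        + (+ length (y ∷ ys) - + ascents (y ∷ ys)) * g (suc (ascents (y ∷ ys)))
  Σ-insertions-tail x y [] g y<x [] =
    trans (cong (λ c → g (c ℕ.+ 0) + 0ℤ) (step-< y<x)) (lem (g 0) (g 1))
    where lem : ∀ a b → b + 0ℤ ≡ 0ℤ * a + (1ℤ - 0ℤ) * b
          lem = solve-∀
  Σ-insertions-tail x y (z ∷ zs) g y<x (z<x ∷ zs<x) = begin
    g (step y x ℕ.+ (step x z ℕ.+ a)) + Σᴸ (map (z ∷_) (insertions x zs)) (λ us → g (ascents (y ∷ us)))
      ≡⟨ cong₂ _+_ (cong₂ (λ b c → g (b ℕ.+ (c ℕ.+ a))) (step-< y<x) (step-≮ (ℕ.<-asym z<x)))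
          (Σᴸ-map (z ∷_) (insertions x zs) (λ us → g (ascents (y ∷ us)))) ⟩
    g (suc a) + Σᴸ (insertions x zs) (λ us → g (step y z ℕ.+ ascents (z ∷ us)))
      -- The recursion sees only ascents from `z` on, so the comparison of `y` with `z` is moved
      -- into the weight.
      ≡⟨ cong (λ t → g (suc a) + t) (Σ-insertions-tail x z zs (λ b → g (step y z ℕ.+ b)) z<x zs<x) ⟩
    g (suc a) + (+ a * g (step y z ℕ.+ a) + (+ n - + a) * g (step y z ℕ.+ suc a))
      ≡⟨ gap ⟩
    + (step y z ℕ.+ a) * g (step y z ℕ.+ a) + (+ suc n - + (step y z ℕ.+ a)) * g (suc (step y z ℕ.+ a)) ∎
    where
    open ≡-Reasoning
    a = ascents (z ∷ zs)
    n = length (z ∷ zs)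
    gap : g (suc a) + (+ a * g (step y z ℕ.+ a) + (+ n - + a) * g (step y z ℕ.+ suc a))
        ≡ + (step y z ℕ.+ a) * g (step y z ℕ.+ a) + (+ suc n - + (step y z ℕ.+ a)) * g (suc (step y z ℕ.+ a))
    gap with ⌊ y ℕ.<? z ⌋
    ... | true  = lem (+ a) (+ n) (g (suc a)) (g (suc (suc a)))
      where lem : ∀ a n b c → b + (a * b + (n - a) * c) ≡ (1ℤ + a) * b + ((1ℤ + n) - (1ℤ + a)) * c
            lem = solve-∀
    ... | false = lem (+ a) (+ n) (g a) (g (suc a))
      where lem : ∀ a n b c → c + (a * b + (n - a) * c) ≡ a * b + ((1ℤ + n) - a) * c
            lem = solve-∀

  -- The place in front creates a descent and keeps the number of ascents; it accounts for the 1 in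
  -- the weight 1 + a.
  Σ-insertions : ∀ x ys n (g : ℕ → ℤ) → All (ℕ._< x) ys → length ys ≡ suc n →
    Σᴸ (insertions x ys) (g ∘ ascents)
      ≡ (1ℤ + + ascents ys) * g (ascents ys) + (+ suc n - + ascents ys) * g (suc (ascents ys))
  Σ-insertions x (y ∷ ys) n g (y<x ∷ ys<x) len = begin
    g (step x y ℕ.+ a) + Σᴸ (map (y ∷_) (insertions x ys)) (g ∘ ascents)
      ≡⟨ cong₂ _+_ (cong (λ c → g (c ℕ.+ a)) (step-≮ (ℕ.<-asym y<x))) (Σᴸ-map (y ∷_) (insertions x ys) (g ∘ ascents)) ⟩
    g a + Σᴸ (insertions x ys) (λ zs → g (ascents (y ∷ zs)))
      ≡⟨ cong (λ t → g a + t) (Σ-insertions-tail x y ys g y<x ys<x) ⟩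
    g a + (+ a * g a + (+ length (y ∷ ys) - + a) * g (suc a))
      ≡⟨ cong (λ l → g a + (+ a * g a + (+ l - + a) * g (suc a))) len ⟩
    g a + (+ a * g a + (+ suc n - + a) * g (suc a))
      ≡⟨ lem (+ a) (+ suc n) (g a) (g (suc a)) ⟩
    (1ℤ + + a) * g a + (+ suc n - + a) * g (suc a) ∎
    where
    open ≡-Reasoning
    a = ascents (y ∷ ys)
    lem : ∀ a n b c → b + (a * b + (n - a) * c) ≡ (1ℤ + a) * b + (n - a) * c
    lem = solve-∀

  Fits : ℕ → List ℕ → Set
  Fits n σ = All (ℕ._≤ n) σ × length σ ≡ n

  insertions-fit : ∀ x {m} ys → All (ℕ._≤ x) ys → length ys ≡ m →
    All (λ zs → All (ℕ._≤ x) zs × length zs ≡ suc m) (insertions x ys)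
  insertions-fit x []       []          refl = (ℕ.≤-refl ∷ [] , refl) ∷ []
  insertions-fit x (y ∷ ys) (y≤x ∷ ys≤x) refl =
    (ℕ.≤-refl ∷ y≤x ∷ ys≤x , refl) ∷
    All.map⁺ (All.map (λ { (zs≤x , len) → y≤x ∷ zs≤x , cong suc len }) (insertions-fit x ys ys≤x refl))

  permutations-fit : ∀ n → All (Fits n) (permutations n)
  permutations-fit zero    = ([] , refl) ∷ []
  permutations-fit (suc n) = All.concat⁺ (All.map⁺ (All.map
    (λ { {σ} (σ≤n , len) → insertions-fit (suc n) σ (All.map ℕ.m≤n⇒m≤1+n σ≤n) len })
    (permutations-fit n)))

  Σ-permutations : ∀ n g → Σᴸ (permutations (suc n)) (g ∘ ascents) ≡ Eul n g
  Σ-permutations zero    g = +-identityʳ (g 0)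
  Σ-permutations (suc n) g = begin
    Σᴸ (permutations (suc (suc n))) (g ∘ ascents)
      ≡⟨ Σᴸ-concatMap (insertions (suc (suc n))) (permutations (suc n)) (g ∘ ascents) ⟩
    Σᴸ (permutations (suc n)) (λ σ → Σᴸ (insertions (suc (suc n)) σ) (g ∘ ascents))
      ≡⟨ Σᴸ-cong (permutations (suc n)) (All.map
           (λ { {σ} (σ≤ , len) → Σ-insertions (suc (suc n)) σ n g (All.map s≤s σ≤) len })
           (permutations-fit (suc n))) ⟩
    Σᴸ (permutations (suc n)) ((λ a → (1ℤ + + a) * g a + (+ suc n - + a) * g (suc a)) ∘ ascents)
      ≡⟨ Σ-permutations n (λ a → (1ℤ + + a) * g a + (+ suc n - + a) * g (suc a)) ⟩
    Eul (suc n) g ∎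
    where open ≡-Reasoning

  data Parity (n : ℕ) : Set where
    even : n % 2 ≡ 0 → sgn n ≡ 1ℤ → Parity n
    odd  : n % 2 ≢ 0 → sgn n ≡ -1ℤ → Parity n

  parity : ∀ n → Parity n
  parity n with halve n
  ... | isDouble m    = even (double%2 m) (sgn-double m)
  ... | isSucDouble m = odd (λ e → ℕ.1+n≢0 (trans (sym (suc-double%2 m)) e)) (cong -_ (sgn-double m))

  even? : Decidable (λ σ → ascents σ % 2 ≡ 0)
  even? σ = ascents σ % 2 ℕ.≟ 0

  -- 1 + (-1)^asc is twice the indicator of an even number of ascents, hence the factor 2.
  length-filter-even : ∀ σs → + (2 ℕ.* length (filter even? σs))
    ≡ Σᴸ σs (λ σ → 1ℤ + sgn (ascents σ))
  length-filter-even [] = refl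
  length-filter-even (σ ∷ σs) with parity (ascents σ)
  ... | even e s = begin
    + (2 ℕ.* length (filter even? (σ ∷ σs)))
      ≡⟨ cong (λ τs → + (2 ℕ.* length τs)) (filter-accept even? {x = σ} {xs = σs} e) ⟩
    + (2 ℕ.* suc (length (filter even? σs)))
      ≡⟨ cong +_ (ℕ.*-suc 2 (length (filter even? σs))) ⟩
    + 2 + + (2 ℕ.* length (filter even? σs))
      ≡⟨ cong₂ (λ z w → 1ℤ + z + w) (sym s) (length-filter-even σs) ⟩
    1ℤ + sgn (ascents σ) + Σᴸ σs (λ τ → 1ℤ + sgn (ascents τ)) ∎
    where open ≡-Reasoning
  ... | odd o s = begin
    + (2 ℕ.* length (filter even? (σ ∷ σs)))
      ≡⟨ cong (λ τs → + (2 ℕ.* length τs)) (filter-reject even? {x = σ} {xs = σs} o) ⟩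
    + (2 ℕ.* length (filter even? σs))
      ≡⟨ length-filter-even σs ⟩
    Σᴸ σs (λ τ → 1ℤ + sgn (ascents τ))
      ≡⟨ +-identityˡ (Σᴸ σs (λ τ → 1ℤ + sgn (ascents τ))) ⟨
    1ℤ + -1ℤ + Σᴸ σs (λ τ → 1ℤ + sgn (ascents τ))
      ≡⟨ cong (λ z → 1ℤ + z + Σᴸ σs (λ τ → 1ℤ + sgn (ascents τ))) s ⟨
    1ℤ + sgn (ascents σ) + Σᴸ σs (λ τ → 1ℤ + sgn (ascents τ)) ∎
    where open ≡-Reasoning

  twice-evenAscentCount : ∀ n → + (2 ℕ.* evenAscentCount (suc n)) ≡ factorial (suc n) + Eul n sgn
  twice-evenAscentCount n = begin
    + (2 ℕ.* evenAscentCount (suc n))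
      ≡⟨ length-filter-even (permutations (suc n)) ⟩
    Σᴸ (permutations (suc n)) ((λ a → 1ℤ + sgn a) ∘ ascents)
      ≡⟨ Σ-permutations n (λ a → 1ℤ + sgn a) ⟩
    Eul n (λ a → 1ℤ + sgn a)
      ≡⟨ Eul-+ n (λ _ → 1ℤ) sgn ⟩
    Eul n (λ _ → 1ℤ) + Eul n sgn
      ≡⟨ cong (_+ Eul n sgn) (trans (Eul-1 n 1ℤ) (*-identityˡ (factorial (suc n)))) ⟩
    factorial (suc n) + Eul n sgn ∎
    where open ≡-Reasoning

-- Integers inside the rationals, and the Bernoulli recurrence

module Rationals where
  open Modular
  open Eulerian
  open import Data.Nat.Coprimality using (1-coprimeTo) renaming (sym to coprime-sym)
  open import Data.Integer as ℤ using (ℤ; +_; 1ℤ)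
  import Data.Integer.Properties as ℤ
  import Data.Integer.Tactic.RingSolver as ℤ-Solver
  open import Data.Rational using (ℚ; mkℚ; 0ℚ; 1ℚ; _+_; _*_; _-_; -_; _/_; ↥_; ↧_; ↧ₙ_; toℚᵘ)
  open import Data.Rational.Properties
  open import Data.Rational.Unnormalised as ℚᵘ using (mkℚᵘ; *≡*)
  import Data.Rational.Unnormalised.Properties as ℚᵘ
  open import Data.List using ([]; _∷_; [_]; map; zip; upTo; _++_)
  open import Data.List.Properties using (map-++; upTo-∷ʳ)
  open import Data.Maybe using (Maybe; just; nothing)
  open import Level using (0ℓ)
  open import Tactic.RingSolver using (solve-∀)
  open import Tactic.RingSolver.Core.AlmostCommutativeRing using (AlmostCommutativeRing; fromCommutativeRing)

  0≟ : ∀ x → Maybe (0ℚ ≡ x)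
  0≟ x with 0ℚ ≟ x
  ... | yes e = just e
  ... | no _  = nothing

  ℚ-ring : AlmostCommutativeRing 0ℓ 0ℓ
  ℚ-ring = fromCommutativeRing +-*-commutativeRing 0≟

  ι : ℤ → ℚ
  ι z = z / 1

  -- `z / 1` is normalised through a gcd and does not compute for a variable `z`; this form exposes
  -- its numerator and denominator.
  ι≡mkℚ : ∀ z → ι z ≡ mkℚ z 0 (coprime-sym (1-coprimeTo ℤ.∣ z ∣))
  ι≡mkℚ z = ↥p/↧p≡p (mkℚ z 0 _)

  ↥ι : ∀ z → ↥ (ι z) ≡ z
  ↥ι z = cong ↥_ (ι≡mkℚ z)

  ↧ₙι : ∀ z → ↧ₙ (ι z) ≡ 1
  ↧ₙι z = cong ↧ₙ_ (ι≡mkℚ z)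

  toℚᵘ-ι : ∀ z → toℚᵘ (ι z) ℚᵘ.≃ mkℚᵘ z 0
  toℚᵘ-ι z = toℚᵘ-fromℚᵘ (mkℚᵘ z 0)

  ι-+ : ∀ a b → ι (a ℤ.+ b) ≡ ι a + ι b
  ι-+ a b = toℚᵘ-injective (ℚᵘ.≃-trans (toℚᵘ-ι (a ℤ.+ b)) (ℚᵘ.≃-trans (*≡* (lem a b))
    (ℚᵘ.≃-sym (ℚᵘ.≃-trans (toℚᵘ-homo-+ (ι a) (ι b)) (ℚᵘ.+-cong (toℚᵘ-ι a) (toℚᵘ-ι b))))))
    where lem : ∀ a b → (a ℤ.+ b) ℤ.* 1ℤ ≡ (a ℤ.* 1ℤ ℤ.+ b ℤ.* 1ℤ) ℤ.* 1ℤ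
          lem = ℤ-Solver.solve-∀

  ι-* : ∀ a b → ι (a ℤ.* b) ≡ ι a * ι b
  ι-* a b = toℚᵘ-injective (ℚᵘ.≃-trans (toℚᵘ-ι (a ℤ.* b))
    (ℚᵘ.≃-sym (ℚᵘ.≃-trans (toℚᵘ-homo-* (ι a) (ι b)) (ℚᵘ.*-cong (toℚᵘ-ι a) (toℚᵘ-ι b)))))

  ι-neg : ∀ a → ι (ℤ.- a) ≡ - ι a
  ι-neg a = toℚᵘ-injective (ℚᵘ.≃-trans (toℚᵘ-ι (ℤ.- a))
    (ℚᵘ.≃-sym (ℚᵘ.≃-trans (toℚᵘ-homo‿- (ι a)) (ℚᵘ.-‿cong (toℚᵘ-ι a)))))

  ι-recipℕ : ∀ n → ι (+ suc n) * recipℕ (suc n) ≡ 1ℚ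
  ι-recipℕ n = toℚᵘ-injective (ℚᵘ.≃-trans (toℚᵘ-homo-* (ι (+ suc n)) (recipℕ (suc n)))
    (ℚᵘ.≃-trans (ℚᵘ.*-cong (toℚᵘ-ι (+ suc n)) (toℚᵘ-fromℚᵘ (mkℚᵘ 1ℤ n)))
      (*≡* (trans (lem (+ suc n)) (cong (λ m → 1ℤ ℤ.* + suc m) (sym (ℕ.+-identityʳ n)))))))
    where lem : ∀ n → n ℤ.* 1ℤ ℤ.* 1ℤ ≡ 1ℤ ℤ.* n
          lem = ℤ-Solver.solve-∀

  -- Carries an equation between rationals over to numerator and denominator, where divisibility by
  -- `p` can be argued in the integers.
  cross-multiply : ∀ a b x → ι a * x ≡ ι b → a ℤ.* ↥ x ≡ b ℤ.* ↧ x
  cross-multiply a b x@(mkℚ _ d _) e with ℚᵘ.≃-trans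
    (ℚᵘ.≃-sym (ℚᵘ.≃-trans (toℚᵘ-homo-* (ι a) x) (ℚᵘ.*-cong (toℚᵘ-ι a) ℚᵘ.≃-refl)))
    (ℚᵘ.≃-trans (toℚᵘ-cong e) (toℚᵘ-ι b))
  ... | *≡* e′ = trans (sym (ℤ.*-identityʳ _)) (trans e′ (cong (λ m → b ℤ.* + suc m) (ℕ.+-identityʳ d)))

  ι-cancel : ∀ n {x y} → ι (+ suc n) * x ≡ ι (+ suc n) * y → x ≡ y
  ι-cancel n {x} {y} e = trans (lem x) (trans (cong (recipℕ (suc n) *_) e) (sym (lem y)))
    where
    lem′ : ∀ a b x → a * (b * x) ≡ b * a * x
    lem′ = solve-∀ ℚ-ring
    lem : ∀ x → x ≡ recipℕ (suc n) * (ι (+ suc n) * x)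
    lem x = sym (trans (lem′ (recipℕ (suc n)) (ι (+ suc n)) x)
      (trans (cong (_* x) (ι-recipℕ n)) (*-identityˡ x)))

  sumℚ-++ : ∀ xs ys → sumℚ (xs ++ ys) ≡ sumℚ xs + sumℚ ys
  sumℚ-++ []       ys = sym (+-identityˡ (sumℚ ys))
  sumℚ-++ (x ∷ xs) ys = trans (cong (λ z → x + z) (sumℚ-++ xs ys)) (sym (+-assoc x (sumℚ xs) (sumℚ ys)))

  sumℚ-snoc : ∀ xs x → sumℚ (xs ++ [ x ]) ≡ sumℚ xs + x
  sumℚ-snoc xs x = trans (sumℚ-++ xs [ x ]) (cong (λ z → sumℚ xs + z) (+-identityʳ x))

  Σℚ : ℕ → (ℕ → ℚ) → ℚ
  Σℚ zero    f = 0ℚ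
  Σℚ (suc n) f = Σℚ n f + f n

  sumℚ-upTo : ∀ n f → sumℚ (map f (upTo n)) ≡ Σℚ n f
  sumℚ-upTo zero    f = refl
  sumℚ-upTo (suc n) f = begin
    sumℚ (map f (upTo (suc n)))       ≡⟨ cong (sumℚ ∘ map f) (upTo-∷ʳ n) ⟨
    sumℚ (map f (upTo n ++ [ n ]))    ≡⟨ cong sumℚ (map-++ f (upTo n) [ n ]) ⟩
    sumℚ (map f (upTo n) ++ [ f n ])  ≡⟨ sumℚ-snoc (map f (upTo n)) (f n) ⟩
    sumℚ (map f (upTo n)) + f n       ≡⟨ cong (_+ f n) (sumℚ-upTo n f) ⟩
    Σℚ (suc n) f                      ∎
    where open ≡-Reasoning

  bernoulliList≡ : ∀ n → bernoulliList n ≡ map bernoulli (upTo n)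
  bernoulliList≡ zero    = refl
  bernoulliList≡ (suc n) = begin
    bernoulliList n ++ [ bernoulli n ]          ≡⟨ cong (_++ [ bernoulli n ]) (bernoulliList≡ n) ⟩
    map bernoulli (upTo n) ++ [ bernoulli n ]   ≡⟨ map-++ bernoulli (upTo n) [ n ] ⟨
    map bernoulli (upTo n ++ [ n ])             ≡⟨ cong (map bernoulli) (upTo-∷ʳ n) ⟩
    map bernoulli (upTo (suc n))                ∎
    where open ≡-Reasoning

  map-zip-map : ∀ {A B C : Set} (f : A × B → C) (g : A → B) xs →
    map f (zip xs (map g xs)) ≡ map (λ x → f (x , g x)) xs
  map-zip-map f g []       = refl
  map-zip-map f g (x ∷ xs) = cong (f (x , g x) ∷_) (map-zip-map f g xs)

  bernoulli-suc : ∀ m → bernoulli (suc m)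
    ≡ - (recipℕ (suc (suc m)) * Σℚ (suc m) (λ k → ι (suc (suc m) choose k) * bernoulli k))
  bernoulli-suc m = cong (λ z → - (recipℕ (suc (suc m)) * z))
    (trans (cong sumℚ (trans (cong (λ bs → map f (zip (upTo (suc m)) bs)) (bernoulliList≡ (suc m)))
      (map-zip-map f bernoulli (upTo (suc m)))))
      (sumℚ-upTo (suc m) (λ k → ι (suc (suc m) choose k) * bernoulli k)))
    where
    f : ℕ × ℚ → ℚ
    f (k , b) = ι (suc (suc m) choose k) * b

  bernoulli-recurrence : ∀ m → ι (+ suc (suc m)) * bernoulli (suc m)
    ≡ - Σℚ (suc m) (λ k → ι (suc (suc m) choose k) * bernoulli k)
  bernoulli-recurrence m = begin
    c * bernoulli (suc m)           ≡⟨ cong (c *_) (bernoulli-suc m) ⟩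
    c * (- (recipℕ (suc (suc m)) * σ)) ≡⟨ lem c (recipℕ (suc (suc m))) σ ⟩
    - (c * recipℕ (suc (suc m)) * σ)  ≡⟨ cong (λ z → - (z * σ)) (ι-recipℕ (suc m)) ⟩
    - (1ℚ * σ)                      ≡⟨ cong -_ (*-identityˡ σ) ⟩
    - σ                             ∎
    where
    open ≡-Reasoning
    c = ι (+ suc (suc m))
    σ = Σℚ (suc m) (λ k → ι (suc (suc m) choose k) * bernoulli k)
    lem : ∀ c r s → c * (- (r * s)) ≡ - (c * r * s)
    lem = solve-∀ ℚ-ring

-- Residues and digits of p-integral rationals

module Residues (p : ℕ) (p-prime : Prime p) where
  open Modular
  open PowerSums
  open Rationals
  open import Data.Nat.DivMod using (_/_)
  open import Data.Bool using (Bool; true; false; T)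
  open import Data.Integer using (+_; 1ℤ; _+_; _*_; _-_; -_; _^_; ∣_∣)
  open import Data.Integer.Properties
  open import Data.Integer.DivMod using (_%ℕ_; _/ℕ_; a≡a%ℕn+[a/ℕn]*n; n%ℕd<d)
  open import Data.Integer.Divisibility.Signed renaming (_∣_ to _∣ℤ_)
  open import Data.Integer.Tactic.RingSolver using (solve-∀)
  open import Data.Rational using (ℚ; ↥_; ↧ₙ_)
  open import Data.List using (_∷_; upTo)
  open import Data.List.Membership.Propositional using (_∈_)
  open import Data.List.Membership.Propositional.Properties using (∈-upTo⁺; ∈-upTo⁻)
  open import Data.List.Relation.Unary.Any using (here; there)
  open import Data.Unit using (tt)
  open import Relation.Nullary.Decidable using (⌊_⌋; isYes≗does; dec-true; toWitness)
  open PrimeModulus p p-prime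

  firstWith-spec : ∀ (f : ℕ → Bool) xs {r} → r ∈ xs → f r ≡ true →
    f (firstWith f xs) ≡ true × firstWith f xs ∈ xs
  firstWith-spec f (x ∷ xs) r∈ fr with f x in fx
  ... | true = fx , here refl
  firstWith-spec f (x ∷ xs) (here refl) fr | false = contradiction (trans (sym fr) fx) λ ()
  firstWith-spec f (x ∷ xs) (there r∈) fr | false with firstWith-spec f xs r∈ fr
  ... | ok , ∈xs = ok , there ∈xs

  residue-spec : ∀ k x y → + ↧ₙ x * y ≅ 1ℤ [ + (p ℕ.^ k) ] →
    residue p k x ℕ.< p ℕ.^ k × ↥ x ≅ + ↧ₙ x * + residue p k x [ + (p ℕ.^ k) ]
  residue-spec k x y inverse = ∈-upTo⁻ (proj₂ found) ,
    mod (∣ᵤ⇒∣ (toWitness (subst T (sym (proj₁ found)) tt)))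
    where
    M = p ℕ.^ k
    instance
      M≢0 : ℕ.NonZero M
      M≢0 = ℕ.m^n≢0 p k
    f : ℕ → Bool
    f r = ⌊ M ℕ.∣? ∣ ↥ x - + ↧ₙ x * + r ∣ ⌋
    z = ↥ x * y
    -- Numerator times inverse denominator, reduced modulo `M`: a witness that the search succeeds
    -- and does not fall back on its default 0.
    r = z %ℕ M
    z≅r : z ≅ + r [ + M ]
    z≅r = mod (divides (z /ℕ M) (trans (cong (_- + r) (a≡a%ℕn+[a/ℕn]*n z M)) (lem (+ r) (z /ℕ M * + M))))
      where lem : ∀ a b → a + b - a ≡ b
            lem = solve-∀
    solves : + M ∣ℤ ↥ x - + ↧ₙ x * + r
    solves = ∣diff (≅-sym (≅-trans (≅-*ˡ (+ ↧ₙ x) (≅-sym z≅r))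
      (≅-trans (≅-reflexive (lem (+ ↧ₙ x) (↥ x) y)) (≅-trans (≅-*ˡ (↥ x) inverse) (≅-reflexive (*-identityʳ (↥ x)))))))
      where lem : ∀ d a y → d * (a * y) ≡ a * (d * y)
            lem = solve-∀
    found : f (firstWith f (upTo M)) ≡ true × firstWith f (upTo M) ∈ upTo M
    found = firstWith-spec f (upTo M) (∈-upTo⁺ (n%ℕd<d z M))
      (trans (isYes≗does (M ℕ.∣? ∣ ↥ x - + ↧ₙ x * + r ∣)) (dec-true (M ℕ.∣? ∣ ↥ x - + ↧ₙ x * + r ∣) (∣⇒∣ᵤ solves)))

  div′≡/ : ∀ m n .{{_ : ℕ.NonZero n}} → m div′ n ≡ m / n
  div′≡/ m (suc n) = refl

  P^1≡ : + (p ℕ.^ 1) ≡ P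
  P^1≡ = cong +_ (ℕ.*-identityʳ p)

  P^2≡ : + (p ℕ.^ 2) ≡ P * P
  P^2≡ = trans (pos-* p (p ℕ.^ 1)) (cong (P *_) P^1≡)

  digit₀≡ : ∀ x → digit p x 0 ≡ residue p 1 x
  digit₀≡ x = ℕ.n/1≡n (residue p 1 x)

  digit₁≡ : ∀ x → digit p x 1 ≡ residue p 2 x / p
  digit₁≡ x = trans (cong (residue p 2 x div′_) (ℕ.*-identityʳ p)) (div′≡/ (residue p 2 x) p)

  inverse : ∀ d → ¬ P ∣ℤ + d → ∃ λ y → + d * y ≅ 1ℤ [ P ]
  inverse d ∤d = (+ d) ^ ℕ.pred (ℕ.pred p) , fermat (suc (ℕ.pred (ℕ.pred p)))
    (sym (trans (cong suc (ℕ.suc-pred (ℕ.pred p) {{ℕ.>-nonZero (ℕ.≤-pred (subst (1 ℕ.<_) (sym (ℕ.suc-pred p)) 1<p))}})) (ℕ.suc-pred p))) ∤d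

  -- Newton's iteration for the inverse: replacing `y` by y (2 - d y) squares the error d y - 1 up
  -- to sign.
  lift-inverse : ∀ d y → d * y ≅ 1ℤ [ P ] → d * (y * (+ 2 - d * y)) ≅ 1ℤ [ P * P ]
  lift-inverse d y (mod e) = mod (∣-by (lem d y) (∣m⇒∣-m (∣∣⇒*∣* e e)))
    where lem : ∀ d y → d * (y * (+ 2 - d * y)) - 1ℤ ≡ - ((d * y - 1ℤ) * (d * y - 1ℤ))
          lem = solve-∀

  module _ (x : ℚ) (∤↧ : ¬ P ∣ℤ + ↧ₙ x) where

    private
      y = inverse (↧ₙ x) ∤↧
      y₂ = lift-inverse (+ ↧ₙ x) (proj₁ y) (proj₂ y)
      spec₁ = residue-spec 1 x (proj₁ y) (subst (+ ↧ₙ x * proj₁ y ≅ 1ℤ [_]) (sym P^1≡) (proj₂ y))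
      spec₂ = residue-spec 2 x (proj₁ y * (+ 2 - + ↧ₙ x * proj₁ y))
        (subst (+ ↧ₙ x * (proj₁ y * (+ 2 - + ↧ₙ x * proj₁ y)) ≅ 1ℤ [_]) (sym P^2≡) y₂)

    residue₁< : residue p 1 x ℕ.< p
    residue₁< = subst (residue p 1 x ℕ.<_) (ℕ.*-identityʳ p) (proj₁ spec₁)

    residue₁≅ : ↥ x ≅ + ↧ₙ x * + residue p 1 x [ P ]
    residue₁≅ = subst (↥ x ≅ + ↧ₙ x * + residue p 1 x [_]) P^1≡ (proj₂ spec₁)

    residue₂< : residue p 2 x ℕ.< p ℕ.* p
    residue₂< = subst (residue p 2 x ℕ.<_) (cong (p ℕ.*_) (ℕ.*-identityʳ p)) (proj₁ spec₂)

    residue₂≅ : ↥ x ≅ + ↧ₙ x * + residue p 2 x [ P * P ]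
    residue₂≅ = subst (↥ x ≅ + ↧ₙ x * + residue p 2 x [_]) P^2≡ (proj₂ spec₂)

  ∣-small : ∀ {m n} → m ℕ.< n → + n ∣ℤ + m → m ≡ 0
  ∣-small {zero}  m<n d = refl
  ∣-small {suc m} m<n d = contradiction (ℕ.∣⇒≤ (∣⇒∣ᵤ d)) (ℕ.<⇒≱ m<n)

  ≅1-small : ∀ {m} → m ℕ.< p → + m ≅ 1ℤ [ P ] → m ≡ 1
  ≅1-small {zero}  m<p (mod d) = contradiction d ∤-1
  ≅1-small {suc m} m<p (mod d) = cong suc (∣-small (ℕ.<-trans (ℕ.n<1+n m) m<p) (∣-by (lem (+ m)) d))
    where lem : ∀ m → m ≡ (1ℤ + m) - 1ℤ
          lem = solve-∀

  P∣P² : P ∣ℤ P * P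
  P∣P² = ∣m⇒∣m*n P ∣-refl

  -- Digit 1 is the quotient by `p` of the residue modulo p², so its vanishing says only that this
  -- residue is below `p`; digit 0 supplies its divisibility by `p`.
  digits-zero : ∀ x → ¬ P ∣ℤ + ↧ₙ x →
    P * P ∣ℤ ↥ x ⇔ (digit p x 0 ≡ 0 × digit p x 1 ≡ 0)
  digits-zero x ∤↧ = mk⇔ to from
    where
    R₁ = residue p 1 x
    R₂ = residue p 2 x
    R₁≅ = residue₁≅ x ∤↧
    R₂≅ = residue₂≅ x ∤↧
    to : P * P ∣ℤ ↥ x → digit p x 0 ≡ 0 × digit p x 1 ≡ 0
    to d = trans (digit₀≡ x) R₁≡0 , trans (digit₁≡ x) (trans (cong (_/ p) R₂≡0) (ℕ.0/n≡0 p))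
      where
      R₁≡0 : R₁ ≡ 0
      R₁≡0 = ∣-small (residue₁< x ∤↧) (P∣*⇒P∣ ∤↧ (∣-≅ (≅-sym R₁≅) (∣-trans P∣P² d)))
      R₂≡0 : R₂ ≡ 0
      R₂≡0 = ∣-small (residue₂< x ∤↧) (subst (_∣ℤ + R₂) (sym (pos-* p p)) (P²∣*⇒P²∣ ∤↧ (∣-≅ (≅-sym R₂≅) d)))
    from : digit p x 0 ≡ 0 × digit p x 1 ≡ 0 → P * P ∣ℤ ↥ x
    from (d₀ , d₁) = ∣-≅ R₂≅ (∣-by (cong (λ r → + ↧ₙ x * + r) R₂≡0) (∣n⇒∣m*n (+ ↧ₙ x) (∣0 (P * P))))
      where
      P∣↥ : P ∣ℤ ↥ x
      P∣↥ = ∣-≅ R₁≅ (∣-by (cong (λ r → + ↧ₙ x * + r) (trans (sym (digit₀≡ x)) d₀)) (∣n⇒∣m*n (+ ↧ₙ x) (∣0 P)))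
      R₂≡0 : R₂ ≡ 0
      R₂≡0 = ∣-small (ℕ.m/n≡0⇒m<n (trans (sym (digit₁≡ x)) d₁))
        (P∣*⇒P∣ ∤↧ (∣-≅ (≅-sym (≅-weaken P∣P² R₂≅)) P∣↥))

  module NaturalDigits (n : ℕ) where

    private
      x = ι (+ n)
      ∤↧ : ¬ P ∣ℤ + ↧ₙ x
      ∤↧ d = ∤1 (subst (λ m → P ∣ℤ + m) (↧ₙι (+ n)) d)
      simplify : ∀ {M R} → ↥ x ≅ + ↧ₙ x * + R [ M ] → + n ≅ + R [ M ]
      simplify {M} {R} e = subst₂ (_≅_[ M ]) (↥ι (+ n))
        (trans (cong (λ m → + m * + R) (↧ₙι (+ n))) (*-identityˡ (+ R))) e
      R₂ = residue p 2 x

    digit₀< : digit p x 0 ℕ.< p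
    digit₀< = subst (ℕ._< p) (sym (digit₀≡ x)) (residue₁< x ∤↧)

    digit₀≅ : + n ≅ + digit p x 0 [ P ]
    digit₀≅ = subst (λ r → + n ≅ + r [ P ]) (sym (digit₀≡ x)) (simplify (residue₁≅ x ∤↧))

    -- The two digits come from two separate searches, modulo `p` and modulo p². They are reconciled
    -- by reducing the second residue modulo `p`.
    digit₁≅ : digit p x 0 ≡ 1 → + n ≅ 1ℤ + + digit p x 1 * P [ P * P ]
    digit₁≅ d₀ = ≅-trans n≅R₂ (≅-reflexive (trans R₂≡ (cong₂ (λ a b → + a + + b * P) R₂%p≡1 (sym (digit₁≡ x)))))
      where
      n≅R₂ : + n ≅ + R₂ [ P * P ]
      n≅R₂ = simplify (residue₂≅ x ∤↧)
      R₂≡ : + R₂ ≡ + (R₂ % p) + + (R₂ / p) * P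
      R₂≡ = trans (cong +_ (ℕ.m≡m%n+[m/n]*n R₂ p)) (cong (λ z → + (R₂ % p) + z) (pos-* (R₂ / p) p))
      R₂%p≡1 : R₂ % p ≡ 1
      R₂%p≡1 = ≅1-small (ℕ.m%n<n R₂ p) (≅-trans
        (≅-sym (mod (divides (+ (R₂ / p)) (trans (cong (_- + (R₂ % p)) R₂≡) (lem (+ (R₂ % p)) (+ (R₂ / p) * P))))))
        (≅-trans (≅-sym (≅-weaken P∣P² n≅R₂)) (subst (λ d → + n ≅ + d [ P ]) d₀ digit₀≅)))
        where lem : ∀ a b → a + b - a ≡ b
              lem = solve-∀

-- Power sums against Bernoulli numbers, and the Agoh-Giuga quotient

module Bernoulli (p : ℕ) (p-prime : Prime p) (s : ℕ) (p≡ : p ≡ suc (suc (suc (Modular.double s)))) where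
  open Modular
  open Eulerian
  open PowerSums
  open Rationals
  open OddPrimes p p-prime s p≡
  open import Data.Nat.Coprimality using (recompute)
  open import Data.Nat.Combinatorics using (_C_; nCk≡nC[n∸k]; nC1≡n)
  open import Data.Nat.Induction using (<-rec)
  open import Data.Integer as ℤ using (ℤ; +_; 1ℤ; -1ℤ)
  import Data.Integer.Properties as ℤ
  import Data.Integer.Tactic.RingSolver as ℤ-Solver
  open import Data.Integer.Divisibility.Signed
  open import Data.Rational using (ℚ; mkℚ; 0ℚ; 1ℚ; _+_; _*_; _-_; -_; ↥_; ↧_; ↧ₙ_)
  open import Data.Rational.Properties
  open import Tactic.RingSolver using (solve-∀)

  -- x ∈ M ℤ₍ₚ₎
  record Local (M : ℤ) (x : ℚ) : Set where
    constructor local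
    field
      denominator quot : ℤ
      unit     : ¬ P ∣ denominator
      equation : ι denominator * x ≡ ι (M ℤ.* quot)

  Local-ι : ∀ {M z} → M ∣ z → Local M (ι z)
  Local-ι {M} {z} (divides q eq) =
    local 1ℤ q ∤1 (trans (*-identityˡ (ι z)) (cong ι (trans eq (ℤ.*-comm q M))))

  Local-+ : ∀ {M x y} → Local M x → Local M y → Local M (x + y)
  Local-+ {M} {x} {y} (local b a ∤b e) (local d c ∤d f) =
    local (b ℤ.* d) (d ℤ.* a ℤ.+ b ℤ.* c) (∤-* ∤b ∤d) (begin
      ι (b ℤ.* d) * (x + y)             ≡⟨ cong (_* (x + y)) (ι-* b d) ⟩
      ι b * ι d * (x + y)               ≡⟨ lem (ι b) (ι d) x y ⟩
      ι d * (ι b * x) + ι b * (ι d * y) ≡⟨ cong₂ (λ u v → ι d * u + ι b * v) e f ⟩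
      ι d * ι (M ℤ.* a) + ι b * ι (M ℤ.* c)
        ≡⟨ cong₂ _+_ (ι-* d (M ℤ.* a)) (ι-* b (M ℤ.* c)) ⟨
      ι (d ℤ.* (M ℤ.* a)) + ι (b ℤ.* (M ℤ.* c))
        ≡⟨ ι-+ (d ℤ.* (M ℤ.* a)) (b ℤ.* (M ℤ.* c)) ⟨
      ι (d ℤ.* (M ℤ.* a) ℤ.+ b ℤ.* (M ℤ.* c))
        ≡⟨ cong ι (lem′ d M a b c) ⟩
      ι (M ℤ.* (d ℤ.* a ℤ.+ b ℤ.* c))   ∎)
    where
    open ≡-Reasoning
    lem : ∀ b d x y → b * d * (x + y) ≡ d * (b * x) + b * (d * y)
    lem = solve-∀ ℚ-ring
    lem′ : ∀ d M a b c → d ℤ.* (M ℤ.* a) ℤ.+ b ℤ.* (M ℤ.* c) ≡ M ℤ.* (d ℤ.* a ℤ.+ b ℤ.* c)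
    lem′ = ℤ-Solver.solve-∀

  Local-* : ∀ {N M c x} → N ∣ c → Local M x → Local (N ℤ.* M) (ι c * x)
  Local-* {N} {M} {c} {x} (divides q refl) (local b a ∤b e) = local b (q ℤ.* a) ∤b (begin
    ι b * (ι (q ℤ.* N) * x)     ≡⟨ lem (ι b) (ι (q ℤ.* N)) x ⟩
    ι (q ℤ.* N) * (ι b * x)     ≡⟨ cong (ι (q ℤ.* N) *_) e ⟩
    ι (q ℤ.* N) * ι (M ℤ.* a)   ≡⟨ ι-* (q ℤ.* N) (M ℤ.* a) ⟨
    ι (q ℤ.* N ℤ.* (M ℤ.* a))   ≡⟨ cong ι (lem′ q N M a) ⟩
    ι (N ℤ.* M ℤ.* (q ℤ.* a))   ∎)
    where
    open ≡-Reasoning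
    lem : ∀ b c x → b * (c * x) ≡ c * (b * x)
    lem = solve-∀ ℚ-ring
    lem′ : ∀ q N M a → q ℤ.* N ℤ.* (M ℤ.* a) ≡ N ℤ.* M ℤ.* (q ℤ.* a)
    lem′ = ℤ-Solver.solve-∀

  Local-*ˡ : ∀ {M x} c → Local M x → Local M (ι c * x)
  Local-*ˡ {M} {x} c l = subst (λ N → Local N (ι c * x)) (ℤ.*-identityˡ M)
    (Local-* (divides c (sym (ℤ.*-identityʳ c))) l)

  Local-neg : ∀ {M x} → Local M x → Local M (- x)
  Local-neg {M} {x} l = subst (Local M) (lem x) (Local-*ˡ -1ℤ l)
    where lem : ∀ x → - 1ℚ * x ≡ - x
          lem = solve-∀ ℚ-ring

  Local-unit : ∀ {M c x} → ¬ P ∣ c → Local M (ι c * x) → Local M x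
  Local-unit {M} {c} {x} ∤c (local b a ∤b e) = local (b ℤ.* c) a (∤-* ∤b ∤c)
    (trans (trans (cong (_* x) (ι-* b c)) (*-assoc (ι b) (ι c) x)) e)

  Local-P : ∀ {M x} → Local (P ℤ.* M) (ι P * x) → Local M x
  Local-P {M} {x} (local b a ∤b e) = local b a ∤b (ι-cancel (suc (suc r)) (subst
    (λ q → ι q * (ι b * x) ≡ ι q * ι (M ℤ.* a)) (cong +_ p≡) (begin
      ι P * (ι b * x)       ≡⟨ lem (ι P) (ι b) x ⟩
      ι b * (ι P * x)       ≡⟨ e ⟩
      ι (P ℤ.* M ℤ.* a)     ≡⟨ cong ι (ℤ.*-assoc P M a) ⟩
      ι (P ℤ.* (M ℤ.* a))   ≡⟨ ι-* P (M ℤ.* a) ⟩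
      ι P * ι (M ℤ.* a)     ∎)))
    where
    open ≡-Reasoning
    lem : ∀ p b x → p * (b * x) ≡ b * (p * x)
    lem = solve-∀ ℚ-ring

  Local-Σ : ∀ {M} n f → (∀ k → k ℕ.< n → Local M (f k)) → Local M (Σℚ n f)
  Local-Σ {M} zero f l = Local-ι (∣0 M)
  Local-Σ (suc n) f l = Local-+ (Local-Σ n f λ k k<n → l k (ℕ.m<n⇒m<1+n k<n)) (l n ℕ.≤-refl)

  Σℚ-- : ∀ n f g → Σℚ n (λ k → f k - g k) ≡ Σℚ n f - Σℚ n g
  Σℚ-- zero    f g = refl
  Σℚ-- (suc n) f g = trans (cong (_+ (f n - g n)) (Σℚ-- n f g)) (lem (Σℚ n f) (Σℚ n g) (f n) (g n))
    where lem : ∀ a b c d → a - b + (c - d) ≡ a + c - (b + d)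
          lem = solve-∀ ℚ-ring

  Σℚ-cong : ∀ n {f g} → (∀ k → f k ≡ g k) → Σℚ n f ≡ Σℚ n g
  Σℚ-cong zero    e = refl
  Σℚ-cong (suc n) e = cong₂ _+_ (Σℚ-cong n e) (e n)

  Σℚ-*ˡ : ∀ n c f → Σℚ n (λ k → c * f k) ≡ c * Σℚ n f
  Σℚ-*ˡ zero    c f = sym (*-zeroʳ c)
  Σℚ-*ˡ (suc n) c f = trans (cong (_+ c * f n) (Σℚ-*ˡ n c f)) (sym (*-distribˡ-+ c (Σℚ n f) (f n)))

  ι-Σ : ∀ n f → ι (Σ< n f) ≡ Σℚ n (λ k → ι (f k))
  ι-Σ zero    f = refl
  ι-Σ (suc n) f = trans (ι-+ (Σ< n f) (f n)) (cong (_+ ι (f n)) (ι-Σ n f))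

  -- The error of the leading term p B_n in Faulhaber's formula for the sum of k^n over k < p.
  D : ℕ → ℚ
  D n = ι (powerSum n p) - ι P * bernoulli n

  D-zero : D 0 ≡ 0ℚ
  D-zero = trans (cong₂ (λ a b → ι a - b) (trans (Σ-const p 1ℤ) (ℤ.*-identityʳ P)) (*-identityʳ (ι P))) (+-inverseʳ (ι P))

  choose-pred : ∀ n → suc n choose n ≡ + suc n
  choose-pred n = cong +_ (trans (nCk≡nC[n∸k] (ℕ.n≤1+n n))
    (trans (cong (suc n C_) (trans (ℕ.+-∸-assoc 1 {n} {n} ℕ.≤-refl) (cong suc (ℕ.n∸n≡0 n)))) (nC1≡n (suc n))))

  -- For n ≥ 1 the sums Σ_{j ≤ n} C(n+1, j) x_j are p^(n+1) for x_j = powerSum j p and 0 for x_j = B_j.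
  D-recurrence : ∀ m → let n = suc m in
    ι (+ suc n) * D n ≡ ι (P ℤ.^ suc n) - Σℚ n (λ j → ι (suc n choose j) * D j)
  D-recurrence m = begin
    c * (ι S′ - ι P * bernoulli n)
      ≡⟨ lem c (ι S′) (ι P) (bernoulli n) ⟩
    c * ι S′ - ι P * (c * bernoulli n)
      ≡⟨ cong₂ (λ a b → a - ι P * b) S-rec (bernoulli-recurrence m) ⟩
    (ι (P ℤ.^ suc n) - σS) - ι P * (- σB)
      ≡⟨ lem′ (ι (P ℤ.^ suc n)) σS (ι P) σB ⟩
    ι (P ℤ.^ suc n) - (σS - ι P * σB)
      ≡⟨ cong (λ z → ι (P ℤ.^ suc n) - z) σD ⟨
    ι (P ℤ.^ suc n) - Σℚ n (λ j → ι (suc n choose j) * D j) ∎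
    where
    open ≡-Reasoning
    n = suc m
    c = ι (+ suc n)
    S′ = powerSum n p
    σS = Σℚ n (λ j → ι (suc n choose j) * ι (powerSum j p))
    σB = Σℚ n (λ j → ι (suc n choose j) * bernoulli j)
    lem : ∀ c s p b → c * (s - p * b) ≡ c * s - p * (c * b)
    lem = solve-∀ ℚ-ring
    lem′ : ∀ x s p b → (x - s) - p * (- b) ≡ x - (s - p * b)
    lem′ = solve-∀ ℚ-ring
    lem″ : ∀ a b → b ≡ (a + b) - a
    lem″ = solve-∀ ℚ-ring
    S-rec : c * ι S′ ≡ ι (P ℤ.^ suc n) - σS
    S-rec = begin
      c * ι S′
        ≡⟨ cong (λ z → ι z * ι S′) (choose-pred n) ⟨
      ι (suc n choose n) * ι S′
        ≡⟨ lem″ σS (ι (suc n choose n) * ι S′) ⟩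
      Σℚ (suc n) (λ j → ι (suc n choose j) * ι (powerSum j p)) - σS
        ≡⟨ cong (_- σS) (Σℚ-cong (suc n) (λ j → ι-* (suc n choose j) (powerSum j p))) ⟨
      Σℚ (suc n) (λ j → ι (suc n choose j ℤ.* powerSum j p)) - σS
        ≡⟨ cong (_- σS) (ι-Σ (suc n) (λ j → suc n choose j ℤ.* powerSum j p)) ⟨
      ι (Σ< (suc n) (λ j → suc n choose j ℤ.* powerSum j p)) - σS
        ≡⟨ cong (λ z → ι z - σS) (Σ-choose-powerSum n p) ⟩
      ι (P ℤ.^ suc n) - σS ∎
    σD : Σℚ n (λ j → ι (suc n choose j) * D j) ≡ σS - ι P * σB
    σD = begin
      Σℚ n (λ j → ι (suc n choose j) * D j)
        ≡⟨ Σℚ-cong n (λ j → lem (ι (suc n choose j)) (ι (powerSum j p)) (ι P) (bernoulli j)) ⟩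
      Σℚ n (λ j → ι (suc n choose j) * ι (powerSum j p) - ι P * (ι (suc n choose j) * bernoulli j))
        ≡⟨ Σℚ-- n (λ j → ι (suc n choose j) * ι (powerSum j p)) (λ j → ι P * (ι (suc n choose j) * bernoulli j)) ⟩
      σS - Σℚ n (λ j → ι P * (ι (suc n choose j) * bernoulli j))
        ≡⟨ cong (λ z → σS - z) (Σℚ-*ˡ n (ι P) (λ j → ι (suc n choose j) * bernoulli j)) ⟩
      σS - ι P * σB ∎

  P²∣P^ : ∀ n → P ℤ.* P ∣ P ℤ.^ suc (suc n)
  P²∣P^ n = divides (P ℤ.^ n) (lem P (P ℤ.^ n))
    where lem : ∀ p x → p ℤ.* (p ℤ.* x) ≡ x ℤ.* (p ℤ.* p)
          lem = ℤ-Solver.solve-∀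

  P³∣P^ : ∀ n → P ℤ.* (P ℤ.* P) ∣ P ℤ.^ suc (suc (suc n))
  P³∣P^ n = *-monoʳ-∣ P (P²∣P^ n)

  -- Strong induction. For n + 1 < p the leading coefficient of the recurrence is a unit. At n = p -
  -- 1 it is `p`, so the right side must lie in p³: C(p, j) gives the extra `p` for j ≥ 1, `D 0` is
  -- zero, and p ≥ 3 covers p^p.
  P²∣D : ∀ n → n ℕ.< p → Local (P ℤ.* P) (D n)
  P²∣D = <-rec (λ n → n ℕ.< p → Local (P ℤ.* P) (D n)) go
    where
    go : ∀ n → (∀ {k} → k ℕ.< n → k ℕ.< p → Local (P ℤ.* P) (D k)) → n ℕ.< p → Local (P ℤ.* P) (D n)
    go zero    ih n<p = subst (Local (P ℤ.* P)) (sym D-zero) (Local-ι (∣0 (P ℤ.* P)))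
    go n@(suc m) ih n<p with suc n ℕ.≟ p
    ... | no n+1≢p = Local-unit (∤-below n (ℕ.≤∧≢⇒< n<p n+1≢p)) (subst (Local (P ℤ.* P)) (sym (D-recurrence m))
      (Local-+ (Local-ι (P²∣P^ m)) (Local-neg (Local-Σ n (λ j → ι (suc n choose j) * D j)
        λ j j<n → Local-*ˡ (suc n choose j) (ih j<n (ℕ.<-trans j<n n<p))))))
    ... | yes n+1≡p = Local-P (subst (λ q → Local (P ℤ.* (P ℤ.* P)) (ι q * D n)) (cong +_ n+1≡p)
      (subst (Local (P ℤ.* (P ℤ.* P))) (sym (D-recurrence m))
        (Local-+ (Local-ι P³∣) (Local-neg (Local-Σ n (λ j → ι (suc n choose j) * D j) term)))))
      where
      m≡ : m ≡ suc r
      m≡ = ℕ.suc-injective (ℕ.suc-injective (trans n+1≡p p≡))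
      P³∣ : P ℤ.* (P ℤ.* P) ∣ P ℤ.^ suc n
      P³∣ = subst (λ k → P ℤ.* (P ℤ.* P) ∣ P ℤ.^ suc (suc k)) (sym m≡) (P³∣P^ r)
      term : ∀ j → j ℕ.< n → Local (P ℤ.* (P ℤ.* P)) (ι (suc n choose j) * D j)
      term zero    _   = subst (Local (P ℤ.* (P ℤ.* P))) (sym (trans (cong (ι (suc n choose 0) *_) D-zero) (*-zeroʳ (ι (suc n choose 0)))))
        (Local-ι (∣0 (P ℤ.* (P ℤ.* P))))
      term (suc j) j<n = Local-*
        (subst (λ q → P ∣ q choose suc j) (trans (ℕ.+-identityʳ p) (sym n+1≡p))
          (∣choose 0 (suc j) (s≤s z≤n) (ℕ.<-trans j<n n<p)))
        (ih j<n (ℕ.<-trans j<n n<p))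

  coprime-ℚ : ∀ x → P ∣ ↥ x → ¬ P ∣ + ↧ₙ x
  coprime-ℚ (mkℚ n d c) ∣n ∣d = ℕ.<⇒≢ 1<p (sym (recompute c (∣⇒∣ᵤ ∣n , ∣⇒∣ᵤ ∣d)))

  agohGiuga-P : ι P * agohGiuga p ≡ ι P * bernoulli (suc (suc r)) + 1ℚ
  agohGiuga-P = begin
    ι P * ((ι P * bernoulli (p ℕ.∸ 1) + 1ℚ) * recipℕ p)
      ≡⟨ lem (ι P) (ι P * bernoulli (p ℕ.∸ 1) + 1ℚ) (recipℕ p) ⟩
    ι P * recipℕ p * (ι P * bernoulli (p ℕ.∸ 1) + 1ℚ)
      ≡⟨ cong₂ (λ a n → a * (ι P * bernoulli n + 1ℚ))
           (subst (λ q → ι (+ q) * recipℕ q ≡ 1ℚ) (sym p≡) (ι-recipℕ (suc (suc r)))) (cong (ℕ._∸ 1) p≡) ⟩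
    1ℚ * (ι P * bernoulli (suc (suc r)) + 1ℚ)
      ≡⟨ *-identityˡ (ι P * bernoulli (suc (suc r)) + 1ℚ) ⟩
    ι P * bernoulli (suc (suc r)) + 1ℚ ∎
    where
    open ≡-Reasoning
    lem : ∀ p x y → p * (x * y) ≡ p * y * x
    lem = solve-∀ ℚ-ring

  -- Multiplication by `p` turns A into p B_{p-1} + 1, where p B_{p-1} may be replaced by `S` modulo
  -- p². Fractions are in lowest terms, so p ∣ numerator excludes `p` from the denominator.
  agohGiuga-criterion : ∀ d → P ∣ ↥ (ι d + agohGiuga p - ι (+ 2)) ⇔ P ℤ.* P ∣ S ℤ.+ 1ℤ ℤ.+ P ℤ.* d ℤ.- + 2 ℤ.* P
  agohGiuga-criterion d = go (P²∣D (suc (suc r)) 3+r≤p)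
    where
    Y = ι d + agohGiuga p - ι (+ 2)
    B = bernoulli (suc (suc r))
    Z = S ℤ.+ 1ℤ ℤ.+ P ℤ.* d ℤ.- + 2 ℤ.* P
    go : Local (P ℤ.* P) (D (suc (suc r))) → P ∣ ↥ Y ⇔ P ℤ.* P ∣ Z
    go (local b a ∤b e) = mk⇔ to from
      where
      open ≡-Reasoning
      lem₁ : ∀ b p d a t → b * p * (d + a - t) ≡ b * (p * d + p * a - t * p)
      lem₁ = solve-∀ ℚ-ring
      lem₂ : ∀ b x pB s t → b * (x + (pB + 1ℚ) - t) ≡ b * (s + 1ℚ + x - t) - b * (s - pB)
      lem₂ = solve-∀ ℚ-ring
      ι-Z : ι Z ≡ ι S + 1ℚ + ι P * ι d - ι (+ 2) * ι P
      ι-Z = begin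
        ι (S ℤ.+ 1ℤ ℤ.+ P ℤ.* d ℤ.- + 2 ℤ.* P)
          ≡⟨ ι-+ (S ℤ.+ 1ℤ ℤ.+ P ℤ.* d) (ℤ.- (+ 2 ℤ.* P)) ⟩
        ι (S ℤ.+ 1ℤ ℤ.+ P ℤ.* d) + ι (ℤ.- (+ 2 ℤ.* P))
          ≡⟨ cong₂ _+_ (trans (ι-+ (S ℤ.+ 1ℤ) (P ℤ.* d)) (cong₂ _+_ (ι-+ S 1ℤ) (ι-* P d)))
                       (trans (ι-neg (+ 2 ℤ.* P)) (cong -_ (ι-* (+ 2) P))) ⟩
        ι S + 1ℚ + ι P * ι d - ι (+ 2) * ι P ∎
      scaled : ι (b ℤ.* P) * Y ≡ ι (b ℤ.* Z ℤ.- P ℤ.* P ℤ.* a)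
      scaled = begin
        ι (b ℤ.* P) * Y
          ≡⟨ cong (_* Y) (ι-* b P) ⟩
        ι b * ι P * Y
          ≡⟨ lem₁ (ι b) (ι P) (ι d) (agohGiuga p) (ι (+ 2)) ⟩
        ι b * (ι P * ι d + ι P * agohGiuga p - ι (+ 2) * ι P)
          ≡⟨ cong (λ z → ι b * (ι P * ι d + z - ι (+ 2) * ι P)) agohGiuga-P ⟩
        ι b * (ι P * ι d + (ι P * B + 1ℚ) - ι (+ 2) * ι P)
          ≡⟨ lem₂ (ι b) (ι P * ι d) (ι P * B) (ι S) (ι (+ 2) * ι P) ⟩
        ι b * (ι S + 1ℚ + ι P * ι d - ι (+ 2) * ι P) - ι b * (ι S - ι P * B)
          ≡⟨ cong₂ (λ u v → ι b * u - v) (sym ι-Z) e ⟩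
        ι b * ι Z - ι (P ℤ.* P ℤ.* a)
          ≡⟨ cong₂ _+_ (ι-* b Z) (ι-neg (P ℤ.* P ℤ.* a)) ⟨
        ι (b ℤ.* Z) + ι (ℤ.- (P ℤ.* P ℤ.* a))
          ≡⟨ ι-+ (b ℤ.* Z) (ℤ.- (P ℤ.* P ℤ.* a)) ⟨
        ι (b ℤ.* Z ℤ.- P ℤ.* P ℤ.* a) ∎
      -- S ≡ -1 cancels the 1, so one factor `p` can be divided out of `scaled` before numerators
      -- are compared.
      P∣Z : P ∣ Z
      P∣Z = ∣-≅ (≅-+ (≅-+ (≅-+ S≅-1 (≅-refl {1ℤ})) (∣⇒≅0 (∣m⇒∣m*n d ∣-refl)))
        (≅-neg (∣⇒≅0 (∣n⇒∣m*n (+ 2) ∣-refl)))) (∣0 P)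
      z = quotient P∣Z
      Z≡ : Z ≡ z ℤ.* P
      Z≡ = _∣_.equality P∣Z
      cross : b ℤ.* ↥ Y ≡ (b ℤ.* z ℤ.- P ℤ.* a) ℤ.* ↧ Y
      cross = ℤ.*-cancelˡ-≡ P (b ℤ.* ↥ Y) ((b ℤ.* z ℤ.- P ℤ.* a) ℤ.* ↧ Y) (begin
        P ℤ.* (b ℤ.* ↥ Y)                           ≡⟨ lem₃ P b (↥ Y) ⟩
        b ℤ.* P ℤ.* ↥ Y                             ≡⟨ cross-multiply (b ℤ.* P) (b ℤ.* Z ℤ.- P ℤ.* P ℤ.* a) Y scaled ⟩
        (b ℤ.* Z ℤ.- P ℤ.* P ℤ.* a) ℤ.* ↧ Y         ≡⟨ cong (λ x → (b ℤ.* x ℤ.- P ℤ.* P ℤ.* a) ℤ.* ↧ Y) Z≡ ⟩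
        (b ℤ.* (z ℤ.* P) ℤ.- P ℤ.* P ℤ.* a) ℤ.* ↧ Y ≡⟨ lem₄ b z P a (↧ Y) ⟩
        P ℤ.* ((b ℤ.* z ℤ.- P ℤ.* a) ℤ.* ↧ Y)       ∎)
        where
        lem₃ : ∀ p b y → p ℤ.* (b ℤ.* y) ≡ b ℤ.* p ℤ.* y
        lem₃ = ℤ-Solver.solve-∀
        lem₄ : ∀ b z p a y → (b ℤ.* (z ℤ.* p) ℤ.- p ℤ.* p ℤ.* a) ℤ.* y ≡ p ℤ.* ((b ℤ.* z ℤ.- p ℤ.* a) ℤ.* y)
        lem₄ = ℤ-Solver.solve-∀
      P∣Pa : P ∣ ℤ.- (P ℤ.* a)
      P∣Pa = ∣m⇒∣-m (∣m⇒∣m*n a ∣-refl)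
      to : P ∣ ↥ Y → P ℤ.* P ∣ Z
      to P∣Y = ∣-by Z≡ (*-monoˡ-∣ P (P∣*⇒P∣ ∤b (∣m+n∣n⇒∣m
        (P∣*⇒P∣ (coprime-ℚ Y P∣Y) (∣-by (trans (ℤ.*-comm (↧ Y) (b ℤ.* z ℤ.- P ℤ.* a)) (sym cross)) (∣n⇒∣m*n b P∣Y))) P∣Pa)))
      from : P ℤ.* P ∣ Z → P ∣ ↥ Y
      from P²∣Z = P∣*⇒P∣ ∤b (∣-by cross (∣m⇒∣m*n (↧ Y)
        (∣m∣n⇒∣m+n (∣n⇒∣m*n b (*-cancelʳ-∣ P (∣-by (sym Z≡) P²∣Z))) P∣Pa)))

-- The two equivalences

module Criteria where
  open Modular
  open Eulerian
  open PowerSums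
  open Rationals
  open Harmonic
  open Permutations using (twice-evenAscentCount)
  open import Data.Nat.Primality using (prime⇒irreducible)
  open import Data.Integer as ℤ using (+_; 1ℤ; -1ℤ; ∣_∣)
  import Data.Integer.Properties as ℤ
  import Data.Integer.Tactic.RingSolver as ℤ-Solver
  open import Data.Integer.Divisibility.Signed renaming (_∣_ to _∣ℤ_)
  open import Data.Rational using (ℚ; 0ℚ; 1ℚ; _+_; _*_; _-_; ↥_; ↧_; ↧ₙ_)
  open import Data.Rational.Properties
  open import Data.List using ([]; [_]; map; filter; upTo; _++_)
  open import Data.List.Properties using (map-++; upTo-∷ʳ; filter-++; filter-accept; filter-reject)
  open import Data.Sum using (inj₂)
  open import Function.Properties.Equivalence using () renaming (trans to ⇔-trans; sym to ⇔-sym)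
  open import Relation.Unary using (Decidable)
  open import Tactic.RingSolver using (solve-∀)
  open Equivalence using (to; from)

  odd? : Decidable (λ k → k % 2 ≡ 1)
  odd? k = k % 2 ℕ.≟ 1

  oddSum : ℕ → ℚ
  oddSum n = sumℚ (map recipℕ (filter odd? (map suc (upTo n))))

  oddSum-suc : ∀ n → oddSum (suc n) ≡ oddSum n + sumℚ (map recipℕ (filter odd? [ suc n ]))
  oddSum-suc n = begin
    sumℚ (map recipℕ (filter odd? (map suc (upTo (suc n)))))
      ≡⟨ cong (λ ks → sumℚ (map recipℕ (filter odd? ks)))
           (trans (cong (map suc) (sym (upTo-∷ʳ n))) (map-++ suc (upTo n) [ n ])) ⟩
    sumℚ (map recipℕ (filter odd? (map suc (upTo n) ++ [ suc n ])))
      ≡⟨ cong sumℚ (trans (cong (map recipℕ) (filter-++ odd? (map suc (upTo n)) [ suc n ]))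
                          (map-++ recipℕ (filter odd? (map suc (upTo n))) (filter odd? [ suc n ]))) ⟩
    sumℚ (map recipℕ (filter odd? (map suc (upTo n))) ++ map recipℕ (filter odd? [ suc n ]))
      ≡⟨ sumℚ-++ (map recipℕ (filter odd? (map suc (upTo n)))) (map recipℕ (filter odd? [ suc n ])) ⟩
    oddSum n + sumℚ (map recipℕ (filter odd? [ suc n ])) ∎
    where open ≡-Reasoning

  oddSum-double : ∀ m → oddSum (suc (double (suc m))) ≡ oddSum (suc (double m)) + recipℕ (suc (double (suc m)))
  oddSum-double m = begin
    oddSum (suc (double (suc m)))
      ≡⟨ oddSum-suc (double (suc m)) ⟩
    oddSum (double (suc m)) + sumℚ (map recipℕ (filter odd? [ suc (double (suc m)) ]))
      ≡⟨ cong₂ _+_ (trans (oddSum-suc (suc (double m)))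
           (cong (λ ks → oddSum (suc (double m)) + sumℚ (map recipℕ ks))
             (filter-reject odd? {x = double (suc m)} {xs = []} λ e → ℕ.0≢1+n (trans (sym (double%2 (suc m))) e))))
           (cong (λ ks → sumℚ (map recipℕ ks)) (filter-accept odd? {x = suc (double (suc m))} {xs = []} (suc-double%2 (suc m)))) ⟩
    oddSum (suc (double m)) + 0ℚ + (recipℕ (suc (double (suc m))) + 0ℚ)
      ≡⟨ cong₂ _+_ (+-identityʳ (oddSum (suc (double m)))) (+-identityʳ (recipℕ (suc (double (suc m))))) ⟩
    oddSum (suc (double m)) + recipℕ (suc (double (suc m))) ∎
    where open ≡-Reasoning

  -- `oddSum (suc (double m))` ends at 2m + 1, the (m + 1)-st odd number, hence the index `suc m`.
  e₀*oddSum : ∀ m → ι (e₀ (suc m)) * oddSum (suc (double m)) ≡ ι (e₁ (suc m))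
  e₀*oddSum zero    = refl
  e₀*oddSum (suc m) = begin
    ι (k ℤ.* e₀ (suc m)) * oddSum (suc (double (suc m)))
      ≡⟨ cong₂ _*_ (ι-* k (e₀ (suc m))) (oddSum-double m) ⟩
    ι k * ι (e₀ (suc m)) * (oddSum (suc (double m)) + recipℕ (suc (double (suc m))))
      ≡⟨ lem (ι k) (ι (e₀ (suc m))) (oddSum (suc (double m))) (recipℕ (suc (double (suc m)))) ⟩
    ι k * (ι (e₀ (suc m)) * oddSum (suc (double m))) + ι k * recipℕ (suc (double (suc m))) * ι (e₀ (suc m))
      ≡⟨ cong₂ (λ a b → ι k * a + b * ι (e₀ (suc m))) (e₀*oddSum m) (ι-recipℕ (double (suc m))) ⟩
    ι k * ι (e₁ (suc m)) + 1ℚ * ι (e₀ (suc m))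
      ≡⟨ cong₂ _+_ (sym (ι-* k (e₁ (suc m)))) (*-identityˡ (ι (e₀ (suc m)))) ⟩
    ι (k ℤ.* e₁ (suc m)) + ι (e₀ (suc m))
      ≡⟨ ι-+ (k ℤ.* e₁ (suc m)) (e₀ (suc m)) ⟨
    ι (e₁ (suc (suc m))) ∎
    where
    open ≡-Reasoning
    k = odd (suc m)
    lem : ∀ k e h r → k * e * (h + r) ≡ k * (e * h) + k * r * e
    lem = solve-∀ ℚ-ring

  pos-^ : ∀ b n → + (b ℕ.^ n) ≡ (+ b) ℤ.^ n
  pos-^ b zero    = refl
  pos-^ b (suc n) = trans (ℤ.pos-* b (b ℕ.^ n)) (cong (+ b ℤ.*_) (pos-^ b n))

  odd-prime : ∀ p → Prime p → p ≢ 2 → ∃ λ s → p ≡ suc (double (suc s))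
  odd-prime p p-prime p≢2 with halve p
  ... | isSucDouble (suc s) = s , refl
  ... | isSucDouble zero    = contradiction (PrimeModulus.1<p 1 p-prime) (ℕ.<-irrefl refl)
  ... | isDouble m with prime⇒irreducible p-prime {2}
          (∣⇒∣ᵤ {+ 2} {+ double m} (divides (+ m) (trans (+double m) (ℤ.*-comm (+ 2) (+ m)))))
  ...   | inj₂ 2≡p = contradiction (sym 2≡p) p≢2

  module OddPrime (p : ℕ) (p-prime : Prime p) (s : ℕ) (p≡ : p ≡ suc (double (suc s))) where

    open OddPrimes p p-prime s p≡
    open Bernoulli p p-prime s p≡
    open Residues p p-prime

    q : ℕ
    q = (2 ℕ.^ (p ℕ.∸ 1) ℕ.∸ 1) div′ p

    2^≡ : (+ 2) ℤ.^ suc (suc r) ≡ 1ℤ ℤ.+ P ℤ.* + q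
    2^≡ = begin
      (+ 2) ℤ.^ suc (suc r)    ≡⟨ pos-^ 2 (suc (suc r)) ⟨
      + (2 ℕ.^ suc (suc r))    ≡⟨ cong (λ n → + (2 ℕ.^ n)) p∸1≡ ⟨
      + (2 ℕ.^ (p ℕ.∸ 1))      ≡⟨ cong +_ (ℕ.m+[n∸m]≡n (ℕ.m^n>0 2 (p ℕ.∸ 1))) ⟨
      1ℤ ℤ.+ + n               ≡⟨ cong (λ z → 1ℤ ℤ.+ + z) (ℕ.m/n*n≡m p∣n) ⟨
      1ℤ ℤ.+ + (n ℕ./ p ℕ.* p) ≡⟨ cong (λ z → 1ℤ ℤ.+ + (z ℕ.* p)) (div′≡/ n p) ⟨
      1ℤ ℤ.+ + (q ℕ.* p)       ≡⟨ cong (λ z → 1ℤ ℤ.+ z) (trans (ℤ.pos-* q p) (ℤ.*-comm (+ q) P)) ⟩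
      1ℤ ℤ.+ P ℤ.* + q         ∎
      where
      open ≡-Reasoning
      n = 2 ℕ.^ (p ℕ.∸ 1) ℕ.∸ 1
      p∸1≡ : p ℕ.∸ 1 ≡ suc (suc r)
      p∸1≡ = cong (ℕ._∸ 1) p≡
      n≡ : + n ≡ (+ 2) ℤ.^ suc (suc r) ℤ.- 1ℤ
      n≡ = trans (lem (+ n)) (cong (ℤ._- 1ℤ) (trans
        (cong +_ (trans (ℕ.m+[n∸m]≡n (ℕ.m^n>0 2 (p ℕ.∸ 1))) (cong (2 ℕ.^_) p∸1≡))) (pos-^ 2 (suc (suc r)))))
        where lem : ∀ n → n ≡ (1ℤ ℤ.+ n) ℤ.- 1ℤ
              lem = ℤ-Solver.solve-∀
      p∣n : p ℕ.∣ n
      p∣n = ∣⇒∣ᵤ (∣-by n≡ (∣diff (fermat (suc (suc r)) p≡ ∤2)))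

    superWieferich⇔ : SuperWieferich p ⇔ P ℤ.* P ∣ℤ + q
    superWieferich⇔ = mk⇔ (λ d → subst (_∣ℤ + q) P^2≡ (∣ᵤ⇒∣ d)) (λ d → ∣⇒∣ᵤ (subst (_∣ℤ + q) (sym P^2≡) d))

    superWieferich⇔P²∣E : SuperWieferich p ⇔ P ℤ.* P ∣ℤ E
    superWieferich⇔P²∣E = ⇔-trans superWieferich⇔ (⇔-trans (P²∣q⇔P²∣O (+ q) 2^≡) (⇔-sym P²∣E⇔P²∣O))

    module _ (n : ℕ) (n≡ : + n ≡ factorial (suc r) ℤ.+ E) where

      open NaturalDigits n

      private
        d₀ = digit p (ι (+ n)) 0
        d₁ = digit p (ι (+ n)) 1
        F = factorial (suc r)

      -- Wilson's theorem with the factor p - 1 ≡ -1 split off.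
      F≅1 : F ≅ 1ℤ [ P ]
      F≅1 = mod (∣-by (lem P F) (∣m∣n⇒∣m-n (∣m⇒∣m*n F ∣-refl)
        (subst (λ c → P ∣ℤ c ℤ.* F ℤ.- -1ℤ) P-1≡ (∣diff wilson))))
        where lem : ∀ p f → f ℤ.- 1ℤ ≡ p ℤ.* f ℤ.- ((p ℤ.- 1ℤ) ℤ.* f ℤ.- -1ℤ)
              lem = ℤ-Solver.solve-∀

      Z = S ℤ.+ 1ℤ ℤ.+ P ℤ.* + d₁ ℤ.- + 2 ℤ.* P

      -- (p-2)! is eliminated by adding S - p ≡ (p-1) F, 1 + d₁ p ≡ F + E and p F ≡ p. Of the 2 p in
      -- `Z`, one comes from Glaisher's congruence and one from p F ≡ p.
      Z≅E : d₀ ≡ 1 → Z ≅ E [ P ℤ.* P ]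
      Z≅E d₀≡1 = mod (∣-by (lem S P F E (+ d₁)) (∣m∣n⇒∣m+n (∣m∣n⇒∣m+n
          (subst (λ c → P ℤ.* P ∣ℤ S ℤ.- P ℤ.- c ℤ.* F) P-1≡ (∣diff (≅-sym glaisher)))
          (subst (λ x → P ℤ.* P ∣ℤ 1ℤ ℤ.+ + d₁ ℤ.* P ℤ.- x) n≡ (∣diff (≅-sym (digit₁≅ d₀≡1)))))
          (∣∣⇒*∣* (∣-refl {P}) (∣diff F≅1))))
        where lem : ∀ s p f e d → s ℤ.+ 1ℤ ℤ.+ p ℤ.* d ℤ.- + 2 ℤ.* p ℤ.- e
                      ≡ (s ℤ.- p ℤ.- (p ℤ.- 1ℤ) ℤ.* f) ℤ.+ (1ℤ ℤ.+ d ℤ.* p ℤ.- (f ℤ.+ e)) ℤ.+ p ℤ.* (f ℤ.- 1ℤ)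
              lem = ℤ-Solver.solve-∀

      -- The link between `Z` and `E` presupposes d₀ = 1; in the forward direction this comes first,
      -- from F ≡ 1 and p ∣ E.
      P²∣E⇔digits : ∀ y → P ∣ℤ ↥ y ⇔ P ℤ.* P ∣ℤ Z → P ℤ.* P ∣ℤ E ⇔ (d₀ ≡ 1 × p ℕ.∣ ∣ ↥ y ∣)
      P²∣E⇔digits y criterion = mk⇔
        (λ d → d₀≡1 d , ∣⇒∣ᵤ {P} {↥ y} (from criterion (∣-≅ (Z≅E (d₀≡1 d)) d)))
        (λ { (e , d) → ∣-≅ (≅-sym (Z≅E e)) (to criterion (∣ᵤ⇒∣ {P} {↥ y} d)) })
        where
        d₀≡1 : P ℤ.* P ∣ℤ E → d₀ ≡ 1
        d₀≡1 d = ≅1-small digit₀< (≅-trans (≅-sym digit₀≅) (≅-trans (≅-reflexive n≡)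
          (≅-+ F≅1 (∣⇒≅0 (∣-trans P∣P² d)))))

    superWieferich⇔ascents : let n = 2 ℕ.* evenAscentCount (p ℕ.∸ 2) in SuperWieferich p ⇔
      (digit p (ι (+ n)) 0 ≡ 1 × p ℕ.∣ ∣ ↥ (ι (+ digit p (ι (+ n)) 1) + agohGiuga p - ι (+ 2)) ∣)
    superWieferich⇔ascents = ⇔-trans superWieferich⇔P²∣E (P²∣E⇔digits n n≡ y (agohGiuga-criterion (+ d₁)))
      where
      n = 2 ℕ.* evenAscentCount (p ℕ.∸ 2)
      d₁ = digit p (ι (+ n)) 1
      y = ι (+ d₁) + agohGiuga p - ι (+ 2)
      n≡ : + n ≡ factorial (suc r) ℤ.+ E
      n≡ = trans (cong (λ m → + (2 ℕ.* evenAscentCount (m ℕ.∸ 2))) p≡) (twice-evenAscentCount r)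

  superWieferich⇔oddHarmonic : ∀ p → Prime p → ∀ s → p ≡ suc (double (suc s)) →
    SuperWieferich p ⇔ (digit p (oddHarmonic p) 0 ≡ 0 × digit p (oddHarmonic p) 1 ≡ 0)
  -- For p = 3 both sides are false: q = 1 is not divisible by 9, and the harmonic sum is 1, with
  -- zeroth digit 1.
  superWieferich⇔oddHarmonic p p-prime zero refl = mk⇔
    (λ d → contradiction (ℕ.∣⇒≤ d) (ℕ.<⇒≱ {1} {9} (s≤s (s≤s z≤n)))) (λ { (() , _) })
  superWieferich⇔oddHarmonic p p-prime (suc s) p≡ =
    ⇔-trans superWieferich⇔ (⇔-trans (P²∣q⇔P²∣e₁ (+ q) 2^≡) (⇔-trans P²∣e₁⇔P²∣↥ (digits-zero H ∤↧)))
    where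
    open OddPrime p p-prime (suc s) p≡
    open OddHarmonic p p-prime s p≡ hiding (r)
    open PrimeModulus p p-prime
    open Bernoulli p p-prime (suc s) p≡ using (coprime-ℚ)
    open Residues p p-prime using (digits-zero)
    H = oddHarmonic p
    cross : e₀ h ℤ.* ↥ H ≡ e₁ h ℤ.* ↧ H
    cross = cross-multiply (e₀ h) (e₁ h) H
      (trans (cong (λ q → ι (e₀ h) * oddHarmonic q) p≡) (e₀*oddSum (suc s)))
    ∤↧ : ¬ P ∣ℤ + ↧ₙ H
    -- If `p` divided the denominator, `cross` and p ∤ `e₀ h` would make it divide the numerator
    -- too, against lowest terms.
    ∤↧ d = coprime-ℚ H (P∣*⇒P∣ (∤e₀ h ℕ.≤-refl) (∣-by cross (∣n⇒∣m*n (e₁ h) d))) d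
    P²∣e₁⇔P²∣↥ : P ℤ.* P ∣ℤ e₁ h ⇔ P ℤ.* P ∣ℤ ↥ H
    P²∣e₁⇔P²∣↥ = mk⇔
      (λ d → P²∣*⇒P²∣ (∤e₀ h ℕ.≤-refl) (∣-by cross (∣m⇒∣m*n (↧ H) d)))
      (λ d → P²∣*⇒P²∣ ∤↧ (∣-by (trans (ℤ.*-comm (↧ H) (e₁ h)) (sym cross)) (∣n⇒∣m*n (e₀ h) d)))

open import Data.Nat using (_*_; _∸_)
open import Data.Nat.Divisibility using (_∣_)
open import Data.Integer using (+_; ∣_∣)
open import Data.Rational using (↥_; _/_; _+_; _-_)

theorem13 : (p : ℕ) → Prime p → p ≢ 2 →
  (SuperWieferich p ⇔
    (digit p ((+ (2 * evenAscentCount (p ∸ 2))) / 1) 0 ≡ 1 ×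
     p ∣ ∣ ↥ (((+ digit p ((+ (2 * evenAscentCount (p ∸ 2))) / 1) 1) / 1) + agohGiuga p - (+ 2) / 1) ∣))
  × (SuperWieferich p ⇔
    (digit p (oddHarmonic p) 0 ≡ 0 × digit p (oddHarmonic p) 1 ≡ 0))
theorem13 p p-prime p≢2 =
  let s , p≡ = Criteria.odd-prime p p-prime p≢2 in
  Criteria.OddPrime.superWieferich⇔ascents p p-prime s p≡ ,
  Criteria.superWieferich⇔oddHarmonic p p-prime s p≡
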